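{- Let $p$ be a prime and $\alpha,\beta,\gamma,\lambda$ positive integers such that $w=\alpha+\beta+\gamma+\lambda$ is odd and $p>w+2$. Put $n=\alpha+\beta+\gamma$. Then $$Z_p(\alpha,\beta,\gamma,\lambda)\equiv(-1)^\lambda\Bigg(\sum_{a=1}^{\alpha}\sum_{b=1}^{\beta}\binom{n-a-b-1}{\alpha-a,\beta-b,\gamma-1}t_p(a,b;w-a-b)+\sum_{a=1}^{\alpha}\sum_{c=1}^{\gamma}\binom{n-a-c-1}{\alpha-a,\gamma-c,\beta-1}t_p(a,c;w-a-c)$$ $$+\sum_{b=1}^{\beta}\sum_{c=1}^{\gamma}\binom{n-b-c-1}{\beta-b,\gamma-c,\alpha-1}t_p(b,c;w-b-c)\Bigg)B_{p-w}\pmod p,$$ where for positive integers $x,y,z$ $$t_p(x,y;z)=\sum_{s=0}^{x-1}\binom{s+y-1}{s}h_p(x-s,y+s,z)+\sum_{t=0}^{y-1}\binom{t+x-1}{t}h_p(y-t,x+t,z),$$ and for positive integers $x,y,z$ with $m=x+y+z$, $$h_p(x,y,z)=\frac{1}{2m}\left((-1)^{x}\binom{m}{x}-(-1)^{z}\binom{m}{z}\right).$$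
   Context: Let $\mathcal{P}_p$ be the set of positive integers not divisible by $p$. For positive integers $s_1,\dots,s_d$, $Z_p(s_1,\dots,s_d)=\sum_{k_1+\cdots+k_d=p,\ k_i\in\mathcal{P}_p}\frac{1}{k_1^{s_1}\cdots k_d^{s_d}}$. $B_j$ denotes the $j$-th Bernoulli number, and $\binom{N}{i,j,k}=\frac{N!}{i!\,j!\,k!}$ for $i+j+k=N$ is the multinomial coefficient. Congruences are in the ring of $p$-integral rationals. -}

module Defs where

open import Data.Nat as ℕ using (ℕ; zero; suc; _∸_)
open import Data.Nat.Divisibility using (_∣?_)
open import Data.Nat.Combinatorics using (_C_)
open import Data.Nat.Base using (_!)
open import Data.Integer as ℤ using (ℤ; +_)
open import Data.Integer.Divisibility as ℤD using ()
open import Data.Rational using (ℚ; _+_; _*_; _-_; -_; _/_; ↥_; 0ℚ; 1ℚ)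
open import Data.List using (List; []; _∷_; map; foldr; upTo; _++_; length)
open import Relation.Nullary using (does)
open import Data.Bool using (if_then_else_)
open import Data.Product using (_×_; _,_)

ℕtoℚ : ℕ → ℚ
ℕtoℚ n = (+ n) / 1

-- reciprocal of a natural number; used only at nonzero arguments (inv 0 = 0 is a dummy)
inv : ℕ → ℚ
inv zero    = 0ℚ
inv (suc n) = (+ 1) / suc n

sgn : ℕ → ℚ
sgn zero    = 1ℚ
sgn (suc n) = - sgn n

sumℚ : List ℚ → ℚ
sumℚ = foldr _+_ 0ℚ

Σ[_to_] : ℕ → ℕ → (ℕ → ℚ) → ℚ
Σ[ lo to hi ] f = sumℚ (map (λ i → f (lo ℕ.+ i)) (upTo (suc hi ∸ lo)))

-- Bernoulli numbers (B₁ = -1/2 convention) via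
-- B₀ = 1, Bₙ = -1/(n+1) Σ_{k<n} C(n+1,k) B_k.
-- bernList n = [B₀, …, Bₙ]
indexed : ℕ → List ℚ → List (ℕ × ℚ)
indexed i []       = []
indexed i (x ∷ xs) = (i , x) ∷ indexed (suc i) xs

bernList : ℕ → List ℚ
bernList zero    = 1ℚ ∷ []
bernList (suc n) = prev ++ (next ∷ [])
  where
    prev = bernList n
    m = suc n
    next : ℚ
    next = - (inv (suc m) * sumℚ (map (λ { (k , b) → ℕtoℚ (suc m C k) * b }) (indexed 0 prev)))

lastℚ : List ℚ → ℚ
lastℚ []       = 0ℚ
lastℚ (x ∷ []) = x
lastℚ (x ∷ y ∷ xs) = lastℚ (y ∷ xs)

B : ℕ → ℚ
B n = lastℚ (bernList n)

-- Sum over compositions k₁+…+k_d = N with all kᵢ ≥ 1 and p ∤ kᵢ of Π 1/kᵢ^{sᵢ}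
Zaux : ℕ → ℕ → List ℕ → ℚ
Zaux p zero    []       = 1ℚ
Zaux p (suc N) []       = 0ℚ
Zaux p N       (s ∷ ss) =
  Σ[ 1 to N ] (λ k → if does (p ∣? k) then 0ℚ else (inv (k ℕ.^ s) * Zaux p (N ∸ k) ss))

Z : ℕ → List ℕ → ℚ
Z p s = Zaux p p s

multinom : ℕ → ℕ → ℕ → ℚ
multinom i j k = ℕtoℚ ((i ℕ.+ j ℕ.+ k) !) * inv ((i !) ℕ.* (j !) ℕ.* (k !))

h : ℕ → ℕ → ℕ → ℚ
h x y z = inv (2 ℕ.* m) * (sgn x * ℕtoℚ (m C x) - sgn z * ℕtoℚ (m C z))
  where m = x ℕ.+ y ℕ.+ z

t : ℕ → ℕ → ℕ → ℚ
t x y z = Σ[ 0 to x ∸ 1 ] (λ s → ℕtoℚ ((s ℕ.+ y ∸ 1) C s) * h (x ∸ s) (y ℕ.+ s) z)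
        + Σ[ 0 to y ∸ 1 ] (λ u → ℕtoℚ ((u ℕ.+ x ∸ 1) C u) * h (y ∸ u) (x ℕ.+ u) z)

-- congruence modulo p in the ring of p-integral rationals:
-- x ≡ y (mod p) iff x - y ∈ p ℤ_(p), i.e. p divides the numerator of the reduced fraction x - y
_≡_[mod_] : ℚ → ℚ → ℕ → Set
x ≡ y [mod p ] = (+ p) ℤD.∣ (↥ (x - y))

{-# OPTIONS --safe #-}
-- Write L_s for the power series Σ k^(−s) X^k over 0 < k, p ∤ k, with coefficients modulo p.  Then Z_p(α,β,γ,λ)
-- is the coefficient of X^p in L_α L_β L_γ L_λ, and since L_λ(p − u) = (−1)^λ L_λ(u) it equals
-- (−1)^λ Σ_{u<p} (L_α L_β L_γ)(u) u^(−λ).  The operator θ = X d/dX is a derivation with θ L_{s+1} = L_s, so these sums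
-- obey a Pascal-type recurrence in (α,β,γ); solving it gives the multinomial coefficients and leaves sums with one
-- exponent 0.  The same argument in two variables expresses those by the triple harmonic sums
-- H₃(x,y,z) = Σ_{i<j<k<p} i^(−x) j^(−y) k^(−z), with the binomial coefficients of t.
-- In odd weight, stuffle and reflection k ↦ p − k give 2 H₃(x,y,z) = H₂(z,x+y) − H₂(x,y+z), and the double sums H₂
-- follow from Fermat's theorem and the power-sum formula: summing the polynomial Σ_{j<k} j^(p−1−s) in k against
-- k^(−t) only the term k^t survives, whose coefficient is a multiple of B_{p−s−t}.
module Submission where

-- The whole argument takes place among integers modulo p: k^(-1) is represented by the power
-- k^(p-2) (`iv`), and rationals enter only through the relation `↦`, which reads off residues. The
-- obstacle is that p divides the denominator of B_(p-1). Hence an integer sequence `b` imitates the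
-- Bernoulli recursion, and e^X and X/(e^X - 1) are used only in degrees below p, where n! is
-- invertible. The total weight is constant along the recurrences: whenever θ lowers one exponent,
-- the exponent of the sum of the indices rises by one. Once an exponent is 0, the cut-off series
-- L_0, which is X/(1 - X) in degrees below p, turns an equation between indices into an inequality,
-- and a convolution becomes a nested sum. This happens once with three variables and again with
-- two. The multinomial coefficients and the binomials in `t` count lattice paths up to their first
-- arrival at the boundary. In the factor 1/(2w) of `h`, the 2 comes from solving the reflection
-- relation, and w from completing (w - 1)! to the numerator of a binomial coefficient.

module Sequences where

  open import Data.Nat as ℕ using (ℕ; zero; suc; _∸_; _<_; z≤n; s≤s)
  import Data.Nat.Properties as ℕₚ
  open import Data.Nat.Combinatorics using (_C_; nCk+nC[k+1]≡[n+1]C[k+1]; nCn≡1; nCk≡nC[n∸k])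
  open import Data.Integer as ℤ using (ℤ; _+_; _*_; 0ℤ; 1ℤ) renaming (+_ to ι)
  import Data.Integer.Properties as ℤₚ
  open import Data.Integer.Tactic.RingSolver using (solve-∀)
  open import Function using (_∘_)
  open import Relation.Binary.PropositionalEquality
  open ≡-Reasoning

  n<m⇒m∸n≡1+[m∸1+n] : ∀ {m n} → n < m → m ∸ n ≡ suc (m ∸ suc n)
  n<m⇒m∸n≡1+[m∸1+n] {suc m} (s≤s n≤m) = ℕₚ.+-∸-assoc 1 n≤m

  -- Finite sums and formal power series

  Seq : Set
  Seq = ℕ → ℤ

  sum : Seq → ℕ → ℤ
  sum f zero    = 0ℤ
  sum f (suc n) = sum f n + f n

  sum-head : ∀ f n → sum f (suc n) ≡ f 0 + sum (f ∘ suc) n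
  sum-head f zero    = ℤₚ.+-comm 0ℤ (f 0)
  sum-head f (suc n) = trans (cong (_+ f (suc n)) (sum-head f n)) (ℤₚ.+-assoc (f 0) (sum (f ∘ suc) n) (f (suc n)))

  sum-ext : ∀ {f g : Seq} n → (∀ i → i < n → f i ≡ g i) → sum f n ≡ sum g n
  sum-ext zero    e = refl
  sum-ext (suc n) e = cong₂ _+_ (sum-ext n (λ i i<n → e i (ℕₚ.m<n⇒m<1+n i<n))) (e n (ℕₚ.n<1+n n))

  sum-+ : ∀ (f g : Seq) n → sum (λ i → f i + g i) n ≡ sum f n + sum g n
  sum-+ f g zero    = refl
  sum-+ f g (suc n) = trans (cong (_+ (f n + g n)) (sum-+ f g n)) (lem (sum f n) (sum g n) (f n) (g n))
    where
    lem : ∀ a b c d → (a + b) + (c + d) ≡ (a + c) + (b + d)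
    lem = solve-∀

  sum-*ˡ : ∀ c (f : Seq) n → sum (λ i → c * f i) n ≡ c * sum f n
  sum-*ˡ c f zero    = sym (ℤₚ.*-zeroʳ c)
  sum-*ˡ c f (suc n) = trans (cong (_+ c * f n) (sum-*ˡ c f n)) (sym (ℤₚ.*-distribˡ-+ c (sum f n) (f n)))

  sum-*ʳ : ∀ (f : Seq) c n → sum (λ i → f i * c) n ≡ sum f n * c
  sum-*ʳ f c n = trans (sum-ext n (λ i _ → ℤₚ.*-comm (f i) c)) (trans (sum-*ˡ c f n) (ℤₚ.*-comm c (sum f n)))

  sum-zero : ∀ n → sum (λ _ → 0ℤ) n ≡ 0ℤ
  sum-zero zero    = refl
  sum-zero (suc n) = cong (_+ 0ℤ) (sum-zero n)

  sum-swap : ∀ (f : ℕ → ℕ → ℤ) m n → sum (λ i → sum (f i) n) m ≡ sum (λ j → sum (λ i → f i j) m) n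
  sum-swap f zero    n = sym (sum-zero n)
  sum-swap f (suc m) n = trans (cong (_+ sum (f m) n) (sum-swap f m n)) (sym (sum-+ (λ j → sum (λ i → f i j) m) (f m) n))

  -- The product of formal power series, by recursion on the first factor: (f₀ + X f′) g = f₀ g + X (f′ g).
  infixl 7 _⊛_
  _⊛_ : Seq → Seq → Seq
  (f ⊛ g) zero    = f 0 * g 0
  (f ⊛ g) (suc n) = f 0 * g (suc n) + ((f ∘ suc) ⊛ g) n

  ⊛-sum : ∀ f g n → (f ⊛ g) n ≡ sum (λ i → f i * g (n ∸ i)) (suc n)
  ⊛-sum f g zero    = sym (ℤₚ.+-identityˡ (f 0 * g 0))
  ⊛-sum f g (suc n) = begin
    f 0 * g (suc n) + ((f ∘ suc) ⊛ g) n                                ≡⟨ cong ((f 0 * g (suc n)) +_) (⊛-sum (f ∘ suc) g n) ⟩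
    f 0 * g (suc n) + sum (λ i → f (suc i) * g (n ∸ i)) (suc n)         ≡⟨ sum-head (λ i → f i * g (suc n ∸ i)) (suc n) ⟨
    sum (λ i → f i * g (suc n ∸ i)) (suc (suc n))                        ∎

  ⊛-+ˡ : ∀ f f′ g n → ((λ i → f i + f′ i) ⊛ g) n ≡ (f ⊛ g) n + (f′ ⊛ g) n
  ⊛-+ˡ f f′ g zero    = ℤₚ.*-distribʳ-+ (g 0) (f 0) (f′ 0)
  ⊛-+ˡ f f′ g (suc n) = trans (cong (((f 0 + f′ 0) * g (suc n)) +_) (⊛-+ˡ (f ∘ suc) (f′ ∘ suc) g n))
    (lem (f 0) (f′ 0) (g (suc n)) (((f ∘ suc) ⊛ g) n) (((f′ ∘ suc) ⊛ g) n))
    where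
    lem : ∀ a b c d e → (a + b) * c + (d + e) ≡ (a * c + d) + (b * c + e)
    lem = solve-∀

  ⊛-*ˡ : ∀ c f g n → ((λ i → c * f i) ⊛ g) n ≡ c * (f ⊛ g) n
  ⊛-*ˡ c f g zero    = ℤₚ.*-assoc c (f 0) (g 0)
  ⊛-*ˡ c f g (suc n) = trans (cong ((c * f 0 * g (suc n)) +_) (⊛-*ˡ c (f ∘ suc) g n))
    (lem c (f 0) (g (suc n)) (((f ∘ suc) ⊛ g) n))
    where
    lem : ∀ a b c d → a * b * c + a * d ≡ a * (b * c + d)
    lem = solve-∀

  -- The definition peels off the first factor; this peels off the second. Commutativity follows by
  -- comparing the two recursions.
  ⊛-last : ∀ f g n → (f ⊛ g) (suc n) ≡ (f ⊛ (g ∘ suc)) n + f (suc n) * g 0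
  ⊛-last f g zero    = refl
  ⊛-last f g (suc n) = trans (cong ((f 0 * g (suc (suc n))) +_) (⊛-last (f ∘ suc) g n))
    (sym (ℤₚ.+-assoc (f 0 * g (suc (suc n))) (((f ∘ suc) ⊛ (g ∘ suc)) n) (f (suc (suc n)) * g 0)))

  ⊛-comm : ∀ f g n → (f ⊛ g) n ≡ (g ⊛ f) n
  ⊛-comm f g zero    = ℤₚ.*-comm (f 0) (g 0)
  ⊛-comm f g (suc n) = begin
    f 0 * g (suc n) + ((f ∘ suc) ⊛ g) n   ≡⟨ cong₂ _+_ (ℤₚ.*-comm (f 0) (g (suc n))) (⊛-comm (f ∘ suc) g n) ⟩
    g (suc n) * f 0 + (g ⊛ (f ∘ suc)) n   ≡⟨ ℤₚ.+-comm (g (suc n) * f 0) ((g ⊛ (f ∘ suc)) n) ⟩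
    (g ⊛ (f ∘ suc)) n + g (suc n) * f 0   ≡⟨ ⊛-last g f n ⟨
    (g ⊛ f) (suc n)                        ∎

  ⊛-assoc : ∀ f g k n → ((f ⊛ g) ⊛ k) n ≡ (f ⊛ (g ⊛ k)) n
  ⊛-assoc f g k zero    = ℤₚ.*-assoc (f 0) (g 0) (k 0)
  ⊛-assoc f g k (suc n) = begin
    f 0 * g 0 * k (suc n) + ((λ i → f 0 * g (suc i) + ((f ∘ suc) ⊛ g) i) ⊛ k) n
      ≡⟨ cong ((f 0 * g 0 * k (suc n)) +_) (⊛-+ˡ (λ i → f 0 * g (suc i)) ((f ∘ suc) ⊛ g) k n) ⟩
    f 0 * g 0 * k (suc n) + (((λ i → f 0 * g (suc i)) ⊛ k) n + (((f ∘ suc) ⊛ g) ⊛ k) n)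
      ≡⟨ cong ((f 0 * g 0 * k (suc n)) +_) (cong₂ _+_ (⊛-*ˡ (f 0) (g ∘ suc) k n) (⊛-assoc (f ∘ suc) g k n)) ⟩
    f 0 * g 0 * k (suc n) + (f 0 * ((g ∘ suc) ⊛ k) n + ((f ∘ suc) ⊛ (g ⊛ k)) n)
      ≡⟨ lem (f 0) (g 0) (k (suc n)) (((g ∘ suc) ⊛ k) n) (((f ∘ suc) ⊛ (g ⊛ k)) n) ⟩
    f 0 * (g 0 * k (suc n) + ((g ∘ suc) ⊛ k) n) + ((f ∘ suc) ⊛ (g ⊛ k)) n  ∎
    where
    lem : ∀ a b c d e → a * b * c + (a * d + e) ≡ a * (b * c + d) + e
    lem = solve-∀

  -- The Euler operator X·d/dX.
  θ : Seq → Seq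
  θ f n = ι n * f n

  -- Leibniz rule. Shifting `f` by one place turns the weight n into 1 + n, which is why
  -- `(f′ ⊛ g) n` appears next to `θ (f′ ⊛ g) n` in the induction.
  θ-⊛ : ∀ f g n → θ (f ⊛ g) n ≡ (θ f ⊛ g) n + (f ⊛ θ g) n
  θ-⊛ f g zero    = lem (f 0) (g 0)
    where
    lem : ∀ a b → 0ℤ * (a * b) ≡ 0ℤ * a * b + a * (0ℤ * b)
    lem = solve-∀
  θ-⊛ f g (suc n) = begin
    ι (suc n) * (f 0 * g (suc n) + (f′ ⊛ g) n)
      ≡⟨ lem₁ (ι n) (f 0) (g (suc n)) ((f′ ⊛ g) n) ⟩
    f 0 * (ι (suc n) * g (suc n)) + (θ (f′ ⊛ g) n + (f′ ⊛ g) n)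
      ≡⟨ cong (λ x → f 0 * (ι (suc n) * g (suc n)) + (x + (f′ ⊛ g) n)) (θ-⊛ f′ g n) ⟩
    f 0 * (ι (suc n) * g (suc n)) + ((θ f′ ⊛ g) n + (f′ ⊛ θ g) n + (f′ ⊛ g) n)
      ≡⟨ lem₂ (f 0) (ι (suc n)) (g (suc n)) ((θ f′ ⊛ g) n) ((f′ ⊛ θ g) n) ((f′ ⊛ g) n) ⟩
    0ℤ * f 0 * g (suc n) + ((θ f′ ⊛ g) n + (f′ ⊛ g) n) + (f 0 * (ι (suc n) * g (suc n)) + (f′ ⊛ θ g) n)
      ≡⟨ cong (λ x → 0ℤ * f 0 * g (suc n) + x + (f 0 * (ι (suc n) * g (suc n)) + (f′ ⊛ θ g) n)) (⊛-+ˡ (θ f′) f′ g n) ⟨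
    0ℤ * f 0 * g (suc n) + ((λ i → ι i * f′ i + f′ i) ⊛ g) n + (f 0 * (ι (suc n) * g (suc n)) + (f′ ⊛ θ g) n)
      ≡⟨ cong (λ x → 0ℤ * f 0 * g (suc n) + x + (f 0 * (ι (suc n) * g (suc n)) + (f′ ⊛ θ g) n)) (⊛-ext n (λ i → lem₃ (ι i) (f′ i))) ⟩
    (θ f ⊛ g) (suc n) + (f ⊛ θ g) (suc n)  ∎
    where
    f′ = f ∘ suc
    ⊛-ext : ∀ {h h′ : Seq} n → (∀ i → h i ≡ h′ i) → (h ⊛ g) n ≡ (h′ ⊛ g) n
    ⊛-ext zero    e = cong (_* g 0) (e 0)
    ⊛-ext (suc n) e = cong₂ _+_ (cong (_* g (suc n)) (e 0)) (⊛-ext n (e ∘ suc))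
    lem₁ : ∀ n a b c → (1ℤ + n) * (a * b + c) ≡ a * ((1ℤ + n) * b) + (n * c + c)
    lem₁ = solve-∀
    lem₂ : ∀ a m b c d e → a * (m * b) + (c + d + e) ≡ 0ℤ * a * b + (c + e) + (a * (m * b) + d)
    lem₂ = solve-∀
    lem₃ : ∀ n a → n * a + a ≡ (1ℤ + n) * a
    lem₃ = solve-∀

  -- Nested sums

  infixl 6 _⋆_
  -- Summing `f ⋆ g` gives the double sum over i < j; iterating to the left gives multiple harmonic
  -- sums.
  _⋆_ : Seq → Seq → Seq
  (f ⋆ g) n = sum f n * g n

  -- The pairs (i, j) are split into i < j, j < i and i = j.
  stuffle : ∀ f g n → sum f n * sum g n ≡ sum (f ⋆ g) n + sum (g ⋆ f) n + sum (λ i → f i * g i) n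
  stuffle f g zero    = refl
  stuffle f g (suc n) = begin
    (sum f n + f n) * (sum g n + g n)
      ≡⟨ lem₁ (sum f n) (f n) (sum g n) (g n) ⟩
    sum f n * sum g n + (sum f n * g n + sum g n * f n + f n * g n)
      ≡⟨ cong (_+ (sum f n * g n + sum g n * f n + f n * g n)) (stuffle f g n) ⟩
    sum (f ⋆ g) n + sum (g ⋆ f) n + sum (λ i → f i * g i) n + (sum f n * g n + sum g n * f n + f n * g n)
      ≡⟨ lem₂ (sum (f ⋆ g) n) (sum (g ⋆ f) n) (sum (λ i → f i * g i) n) (sum f n * g n) (sum g n * f n) (f n * g n) ⟩
    sum (f ⋆ g) (suc n) + sum (g ⋆ f) (suc n) + sum (λ i → f i * g i) (suc n) ∎
    where
    lem₁ : ∀ a b c d → (a + b) * (c + d) ≡ a * c + (a * d + c * b + b * d)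
    lem₁ = solve-∀
    lem₂ : ∀ a b c d e f → a + b + c + (d + e + f) ≡ (a + d) + (b + e) + (c + f)
    lem₂ = solve-∀

  -- The series 1/(1 - X): multiplication by it takes partial sums.
  one : Seq
  one _ = 1ℤ

  ⊛-one : ∀ f n → (f ⊛ one) n ≡ sum f (suc n)
  ⊛-one f zero    = trans (ℤₚ.*-identityʳ (f 0)) (sym (ℤₚ.+-identityˡ (f 0)))
  ⊛-one f (suc n) = trans (⊛-last f one n) (cong₂ _+_ (⊛-one f n) (ℤₚ.*-identityʳ (f (suc n))))

  -- Reversal is the commutativity of the product with `one`.
  sum-reverse : ∀ f n → sum (λ i → f (n ∸ i)) (suc n) ≡ sum f (suc n)
  sum-reverse f n = begin
    sum (λ i → f (n ∸ i)) (suc n)        ≡⟨ sum-ext (suc n) (λ i _ → sym (ℤₚ.*-identityˡ (f (n ∸ i)))) ⟩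
    sum (λ i → 1ℤ * f (n ∸ i)) (suc n)   ≡⟨ ⊛-sum one f n ⟨
    (one ⊛ f) n                           ≡⟨ ⊛-comm one f n ⟩
    (f ⊛ one) n                           ≡⟨ ⊛-one f n ⟩
    sum f (suc n)                         ∎

  -- Lattice paths and Pascal-type recurrences

  nC0≡1 : ∀ n → n C 0 ≡ 1
  nC0≡1 n = trans (nCk≡nC[n∸k] {0} {n} z≤n) (nCn≡1 n)

  -- The number of lattice paths from (0,0) to (s,c) whose last step, if there is one, increases the second coordinate.
  paths : ℕ → ℕ → ℕ
  paths zero    c       = 1
  paths (suc s) zero    = 0
  paths (suc s) (suc c) = paths s (suc c) ℕ.+ paths (suc s) c

  -- The last step is forced, so what is left is an arbitrary path to (s, c).
  paths≡C : ∀ s c → paths s (suc c) ≡ (s ℕ.+ c) C s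
  paths≡C zero    c       = sym (nC0≡1 c)
  paths≡C (suc s) zero    = begin
    paths s 1 ℕ.+ 0           ≡⟨ ℕₚ.+-identityʳ (paths s 1) ⟩
    paths s 1                 ≡⟨ paths≡C s 0 ⟩
    (s ℕ.+ 0) C s             ≡⟨ cong (_C s) (ℕₚ.+-identityʳ s) ⟩
    s C s                     ≡⟨ nCn≡1 s ⟩
    1                         ≡⟨ nCn≡1 (suc s) ⟨
    suc s C suc s             ≡⟨ cong (_C suc s) (ℕₚ.+-identityʳ (suc s)) ⟨
    (suc s ℕ.+ 0) C suc s     ∎
  paths≡C (suc s) (suc c) = begin
    paths s (suc (suc c)) ℕ.+ paths (suc s) (suc c)         ≡⟨ cong₂ ℕ._+_ (paths≡C s (suc c)) (paths≡C (suc s) c) ⟩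
    (s ℕ.+ suc c) C s ℕ.+ suc (s ℕ.+ c) C suc s             ≡⟨ cong (λ n → (s ℕ.+ suc c) C s ℕ.+ n C suc s) (ℕₚ.+-suc s c) ⟨
    (s ℕ.+ suc c) C s ℕ.+ (s ℕ.+ suc c) C suc s             ≡⟨ nCk+nC[k+1]≡[n+1]C[k+1] (s ℕ.+ suc c) s ⟩
    suc (s ℕ.+ suc c) C suc s                               ∎

  -- Lets a recurrence that refers to index i - 1 hold at i = 0 as well, where that term is absent.
  prev : (ℕ → ℕ) → ℕ → ℕ
  prev g zero    = 0
  prev g (suc i) = g i

  paths-rec : ∀ s c → paths s (suc c) ≡ prev (λ s → paths s (suc c)) s ℕ.+ paths s c
  paths-rec zero    c = refl
  paths-rec (suc s) c = refl

  sum-prev : ∀ (g : ℕ → ℕ) (F : Seq) n → sum (λ i → ι (prev g i) * F i) (suc n) ≡ sum (λ i → ι (g i) * F (suc i)) n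
  sum-prev g F n = trans (sum-head (λ i → ι (prev g i) * F i) n) (ℤₚ.+-identityˡ (sum (λ i → ι (g i) * F (suc i)) n))

  -- The share of the edge values `f x` at (x, 0), x > 0, in the entry (a, c) of a Pascal-type
  -- array. Read downwards from (a, c), a path ends with its first step onto the edge; that step
  -- changes the second coordinate, which is the condition built into `paths`.
  pathSum : (ℕ → ℤ) → ℕ → ℕ → ℤ
  pathSum f a c = sum (λ s → ι (paths s c) * f (a ∸ s)) a

  pathSum-rec : ∀ f a c → pathSum f (suc a) (suc c) ≡ pathSum f a (suc c) + pathSum f (suc a) c
  pathSum-rec f a c = begin
    sum (λ s → ι (paths s (suc c)) * F s) (suc a)
      ≡⟨ sum-ext (suc a) (λ s _ → trans (cong (λ n → ι n * F s) (paths-rec s c))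
           (ℤₚ.*-distribʳ-+ (F s) (ι (prev (λ s → paths s (suc c)) s)) (ι (paths s c)))) ⟩
    sum (λ s → ι (prev (λ s → paths s (suc c)) s) * F s + ι (paths s c) * F s) (suc a)
      ≡⟨ sum-+ (λ s → ι (prev (λ s → paths s (suc c)) s) * F s) (λ s → ι (paths s c) * F s) (suc a) ⟩
    sum (λ s → ι (prev (λ s → paths s (suc c)) s) * F s) (suc a) + pathSum f (suc a) c
      ≡⟨ cong (_+ pathSum f (suc a) c) (sum-prev (λ s → paths s (suc c)) F a) ⟩
    pathSum f a (suc c) + pathSum f (suc a) c ∎
    where
    F : Seq
    F s = f (suc a ∸ s)

  pathSum-0 : ∀ f a → pathSum f (suc a) 0 ≡ f (suc a)
  pathSum-0 f a = begin
    sum (λ s → ι (paths s 0) * f (suc a ∸ s)) (suc a)   ≡⟨ sum-head (λ s → ι (paths s 0) * f (suc a ∸ s)) a ⟩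
    1ℤ * f (suc a) + sum (λ _ → 0ℤ) a                   ≡⟨ cong₂ _+_ (ℤₚ.*-identityˡ (f (suc a))) (sum-zero a) ⟩
    f (suc a) + 0ℤ                                      ≡⟨ ℤₚ.+-identityʳ (f (suc a)) ⟩
    f (suc a)                                           ∎

  -- Paths in three directions whose last step is in the third: the j and c steps are interleaved
  -- with a c step last, and then the i steps are inserted before the end. For positive c this is a
  -- multinomial coefficient with lower entries i, j, c - 1.
  paths₂ : ℕ → ℕ → ℕ → ℕ
  paths₂ i j c = paths j c ℕ.* paths i (j ℕ.+ c)

  paths₂-rec : ∀ i j c → paths₂ i j (suc c) ≡
    prev (λ i → paths₂ i j (suc c)) i ℕ.+ (prev (λ j → paths₂ i j (suc c)) j ℕ.+ paths₂ i j c)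
  paths₂-rec i j c = begin
    paths j (suc c) ℕ.* paths i (j ℕ.+ suc c)
      ≡⟨ cong (λ n → paths j (suc c) ℕ.* paths i n) (ℕₚ.+-suc j c) ⟩
    paths j (suc c) ℕ.* paths i (suc (j ℕ.+ c))
      ≡⟨ cong (paths j (suc c) ℕ.*_) (paths-rec i (j ℕ.+ c)) ⟩
    paths j (suc c) ℕ.* (prev (λ i → paths i (suc (j ℕ.+ c))) i ℕ.+ paths i (j ℕ.+ c))
      ≡⟨ ℕₚ.*-distribˡ-+ (paths j (suc c)) _ (paths i (j ℕ.+ c)) ⟩
    paths j (suc c) ℕ.* prev (λ i → paths i (suc (j ℕ.+ c))) i ℕ.+ paths j (suc c) ℕ.* paths i (j ℕ.+ c)
      ≡⟨ cong₂ ℕ._+_ (first i) (second j) ⟩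
    prev (λ i → paths₂ i j (suc c)) i ℕ.+ (prev (λ j → paths₂ i j (suc c)) j ℕ.+ paths₂ i j c) ∎
    where
    first : ∀ i → paths j (suc c) ℕ.* prev (λ i → paths i (suc (j ℕ.+ c))) i ≡ prev (λ i → paths₂ i j (suc c)) i
    first zero    = ℕₚ.*-zeroʳ (paths j (suc c))
    first (suc i) = cong (λ n → paths j (suc c) ℕ.* paths i n) (sym (ℕₚ.+-suc j c))
    second : ∀ j → paths j (suc c) ℕ.* paths i (j ℕ.+ c) ≡ prev (λ j → paths₂ i j (suc c)) j ℕ.+ paths₂ i j c
    second zero    = refl
    second (suc j) = trans (ℕₚ.*-distribʳ-+ (paths i (suc (j ℕ.+ c))) (paths j (suc c)) (paths (suc j) c))
      (cong (λ n → paths j (suc c) ℕ.* paths i n ℕ.+ paths₂ i (suc j) c) (sym (ℕₚ.+-suc j c)))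

  pathSum₂ : (ℕ → ℕ → ℤ) → ℕ → ℕ → ℕ → ℤ
  pathSum₂ f a b c = sum (λ i → sum (λ j → ι (paths₂ i j c) * f (a ∸ i) (b ∸ j)) b) a

  pathSum₂-rec : ∀ f a b c → pathSum₂ f (suc a) (suc b) (suc c) ≡
    pathSum₂ f a (suc b) (suc c) + pathSum₂ f (suc a) b (suc c) + pathSum₂ f (suc a) (suc b) c
  pathSum₂-rec f a b c = begin
    sum (λ i → sum (λ j → ι (paths₂ i j (suc c)) * F i j) (suc b)) (suc a)
      ≡⟨ sum-ext (suc a) (λ i _ → inner i) ⟩
    sum (λ i → sum (λ j → X i j) (suc b) + (sum (λ j → Y i j) b + sum (λ j → W i j) (suc b))) (suc a)
      ≡⟨ sum-+ (λ i → sum (λ j → X i j) (suc b)) (λ i → sum (λ j → Y i j) b + sum (λ j → W i j) (suc b)) (suc a) ⟩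
    sum (λ i → sum (λ j → X i j) (suc b)) (suc a) + sum (λ i → sum (λ j → Y i j) b + sum (λ j → W i j) (suc b)) (suc a)
      ≡⟨ cong₂ _+_ outer (sum-+ (λ i → sum (λ j → Y i j) b) (λ i → sum (λ j → W i j) (suc b)) (suc a)) ⟩
    pathSum₂ f a (suc b) (suc c) + (pathSum₂ f (suc a) b (suc c) + pathSum₂ f (suc a) (suc b) c)
      ≡⟨ ℤₚ.+-assoc (pathSum₂ f a (suc b) (suc c)) (pathSum₂ f (suc a) b (suc c)) (pathSum₂ f (suc a) (suc b) c) ⟨
    pathSum₂ f a (suc b) (suc c) + pathSum₂ f (suc a) b (suc c) + pathSum₂ f (suc a) (suc b) c ∎
    where
    F X Y W : ℕ → ℕ → ℤ
    F i j = f (suc a ∸ i) (suc b ∸ j)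
    X i j = ι (prev (λ i → paths₂ i j (suc c)) i) * F i j
    Y i j = ι (paths₂ i j (suc c)) * f (suc a ∸ i) (b ∸ j)
    W i j = ι (paths₂ i j c) * F i j
    lem : ∀ x y z d → (x + (y + z)) * d ≡ x * d + (y * d + z * d)
    lem = solve-∀
    inner : ∀ i → sum (λ j → ι (paths₂ i j (suc c)) * F i j) (suc b) ≡
                  sum (λ j → X i j) (suc b) + (sum (λ j → Y i j) b + sum (λ j → W i j) (suc b))
    inner i = begin
      sum (λ j → ι (paths₂ i j (suc c)) * F i j) (suc b)
        ≡⟨ sum-ext (suc b) (λ j _ → trans (cong (λ n → ι n * F i j) (paths₂-rec i j c))
             (lem (ι (prev (λ i → paths₂ i j (suc c)) i)) (ι (prev (λ j → paths₂ i j (suc c)) j)) (ι (paths₂ i j c)) (F i j))) ⟩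
      sum (λ j → X i j + (Y′ j + W i j)) (suc b)
        ≡⟨ sum-+ (λ j → X i j) (λ j → Y′ j + W i j) (suc b) ⟩
      sum (λ j → X i j) (suc b) + sum (λ j → Y′ j + W i j) (suc b)
        ≡⟨ cong (sum (λ j → X i j) (suc b) +_) (sum-+ Y′ (λ j → W i j) (suc b)) ⟩
      sum (λ j → X i j) (suc b) + (sum Y′ (suc b) + sum (λ j → W i j) (suc b))
        ≡⟨ cong (λ z → sum (λ j → X i j) (suc b) + (z + sum (λ j → W i j) (suc b))) (sum-prev (λ j → paths₂ i j (suc c)) (F i) b) ⟩
      sum (λ j → X i j) (suc b) + (sum (λ j → Y i j) b + sum (λ j → W i j) (suc b)) ∎
      where
      Y′ : Seq
      Y′ j = ι (prev (λ j → paths₂ i j (suc c)) j) * F i j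
    outer : sum (λ i → sum (λ j → X i j) (suc b)) (suc a) ≡ pathSum₂ f a (suc b) (suc c)
    outer = begin
      sum (λ i → sum (λ j → X i j) (suc b)) (suc a)
        ≡⟨ sum-head (λ i → sum (λ j → X i j) (suc b)) a ⟩
      sum (λ _ → 0ℤ) (suc b) + pathSum₂ f a (suc b) (suc c)
        ≡⟨ cong (_+ pathSum₂ f a (suc b) (suc c)) (sum-zero (suc b)) ⟩
      0ℤ + pathSum₂ f a (suc b) (suc c)
        ≡⟨ ℤₚ.+-identityˡ (pathSum₂ f a (suc b) (suc c)) ⟩
      pathSum₂ f a (suc b) (suc c) ∎

  pathSum₂-0 : ∀ f a b → pathSum₂ f (suc a) (suc b) 0 ≡ f (suc a) (suc b)
  pathSum₂-0 f a b = begin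
    sum (λ i → sum (T i) (suc b)) (suc a)   ≡⟨ sum-head (λ i → sum (T i) (suc b)) a ⟩
    sum (T 0) (suc b) + sum (λ i → sum (T (suc i)) (suc b)) a
      ≡⟨ cong₂ _+_ row (trans (sum-ext a (λ i _ → trans
           (sum-ext (suc b) (λ j _ → cong (λ n → ι n * f (a ∸ i) (suc b ∸ j)) (vanish i j))) (sum-zero (suc b)))) (sum-zero a)) ⟩
    f (suc a) (suc b) + 0ℤ                  ≡⟨ ℤₚ.+-identityʳ (f (suc a) (suc b)) ⟩
    f (suc a) (suc b)                       ∎
    where
    T : ℕ → ℕ → ℤ
    T i j = ι (paths₂ i j 0) * f (suc a ∸ i) (suc b ∸ j)
    vanish : ∀ i j → paths₂ (suc i) j 0 ≡ 0
    vanish i zero    = refl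
    vanish i (suc j) = refl
    row : sum (T 0) (suc b) ≡ f (suc a) (suc b)
    row = trans (sum-ext (suc b) (λ j _ → cong (λ n → ι n * f (suc a) (suc b ∸ j)) (ℕₚ.*-identityʳ (paths j 0))))
      (pathSum-0 (f (suc a)) b)

  pathSum₂-empty : ∀ f a c → pathSum₂ f a 0 c ≡ 0ℤ
  pathSum₂-empty f a c = sum-zero a

  -- Indexes the sum by the boundary point instead of the distance to it, which is the form of the
  -- double sums in the theorem.
  pathSum₂-reverse : ∀ f a b c → pathSum₂ f (suc a) (suc b) c ≡
    sum (λ i → sum (λ j → ι (paths₂ (a ∸ i) (b ∸ j) c) * f (suc i) (suc j)) (suc b)) (suc a)
  pathSum₂-reverse f a b c = begin
    sum (λ i → sum (λ j → T i j) (suc b)) (suc a)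
      ≡⟨ sum-reverse (λ i → sum (λ j → T i j) (suc b)) a ⟨
    sum (λ i → sum (λ j → T (a ∸ i) j) (suc b)) (suc a)
      ≡⟨ sum-ext (suc a) (λ i _ → sum-reverse (T (a ∸ i)) b) ⟨
    sum (λ i → sum (λ j → T (a ∸ i) (b ∸ j)) (suc b)) (suc a)
      ≡⟨ sum-ext (suc a) (λ i i<1+a → sum-ext (suc b) (λ j j<1+b →
           cong₂ (λ m n → ι (paths₂ (a ∸ i) (b ∸ j) c) * f m n) (index i<1+a) (index j<1+b))) ⟩
    sum (λ i → sum (λ j → ι (paths₂ (a ∸ i) (b ∸ j) c) * f (suc i) (suc j)) (suc b)) (suc a) ∎
    where
    T : ℕ → ℕ → ℤ
    T i j = ι (paths₂ i j c) * f (suc a ∸ i) (suc b ∸ j)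
    index : ∀ {i a} → i < suc a → suc a ∸ (a ∸ i) ≡ suc i
    index {i} {a} (s≤s i≤a) = trans (ℕₚ.+-∸-assoc 1 (ℕₚ.m∸n≤m a i)) (cong suc (ℕₚ.m∸[m∸n]≡n i≤a))

open import Data.Nat using (ℕ)
open import Data.Nat.Primality using (Prime)

module Residues (p : ℕ) (pr : Prime p) where

  open Sequences
  open import Data.Nat as ℕ using (zero; suc; _∸_; _<_; _≤_; z≤n; s≤s; _!)
  import Data.Nat.Properties as ℕₚ
  import Data.Nat.Divisibility as ℕD
  open import Data.Nat.Combinatorics using (_C_; nCk≡n!/k![n-k]!; [n∸k]!k!∣n!; nCk+nC[k+1]≡[n+1]C[k+1]; k>n⇒nCk≡0)
  open import Data.Nat.Combinatorics using (nCn≡1; nCk≡nC[n∸k]; nC1≡n)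
  open import Data.Nat.DivMod using (m/n*n≡m)
  open import Data.Nat.Primality using (euclidsLemma; prime⇒nonTrivial)
  open import Data.Nat.Tactic.RingSolver using () renaming (solve-∀ to solveℕ-∀)
  open import Data.Integer as ℤ using (ℤ; _+_; _*_; _-_; -_; _^_; 0ℤ; 1ℤ) renaming (+_ to ι)
  import Data.Integer.Properties as ℤₚ
  import Data.Integer.Divisibility.Signed as ℤD
  open import Data.Integer.Tactic.RingSolver using (solve-∀)
  open import Data.Rational as ℚ using (ℚ; mkℚ; 0ℚ; toℚᵘ)
  import Data.Rational.Properties as ℚₚ
  open import Data.Rational.Unnormalised as ℚᵘ using (ℚᵘ; mkℚᵘ; *≡*; ↧ₙ_)
  import Data.Rational.Unnormalised.Properties as ℚᵘₚ
  open import Data.Bool using (if_then_else_)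
  open import Data.Empty using (⊥-elim)
  open import Data.List using (List; []; _∷_; map; applyUpTo; _∷ʳ_)
  open import Data.List.Properties using (map-upTo; applyUpTo-∷ʳ)
  open import Data.Product using (_×_; _,_)
  open import Data.Sum using (_⊎_; inj₁; inj₂; [_,_]′)
  open import Function using (_∘_)
  open import Level using (0ℓ)
  open import Relation.Nullary using (¬_; yes; no; does)
  open import Relation.Nullary.Decidable using (dec-true; dec-false)
  open import Relation.Binary using (Setoid)
  open import Relation.Binary.Definitions using (tri<; tri≈; tri>)
  open import Relation.Binary.PropositionalEquality as ≡ using (_≡_)

  -- Congruences modulo p

  infix 4 _≈_
  record _≈_ (a b : ℤ) : Set where
    constructor mod
    field p∣a-b : ι p ℤD.∣ a - b
  open _≈_

  ≡⇒≈ : ∀ {a b} → a ≡ b → a ≈ b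
  ≡⇒≈ {a} ≡.refl = mod (ℤD.divides 0ℤ (lem a))
    where
    lem : ∀ a → a - a ≡ 0ℤ
    lem = solve-∀

  refl : ∀ {a} → a ≈ a
  refl = ≡⇒≈ ≡.refl

  sym : ∀ {a b} → a ≈ b → b ≈ a
  sym {a} {b} (mod d) = mod (≡.subst (ι p ℤD.∣_) (lem a b) (ℤD.∣m⇒∣-m d))
    where
    lem : ∀ a b → - (a - b) ≡ b - a
    lem = solve-∀

  trans : ∀ {a b c} → a ≈ b → b ≈ c → a ≈ c
  trans {a} {b} {c} (mod d) (mod e) = mod (≡.subst (ι p ℤD.∣_) (lem a b c) (ℤD.∣m∣n⇒∣m+n d e))
    where
    lem : ∀ a b c → (a - b) + (b - c) ≡ a - c
    lem = solve-∀

  setoid : Setoid 0ℓ 0ℓ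
  setoid = record { Carrier = ℤ ; _≈_ = _≈_ ; isEquivalence = record { refl = refl ; sym = sym ; trans = trans } }

  open import Relation.Binary.Reasoning.Setoid setoid

  +-cong : ∀ {a b c d} → a ≈ b → c ≈ d → a + c ≈ b + d
  +-cong {a} {b} {c} {d} (mod x) (mod y) = mod (≡.subst (ι p ℤD.∣_) (lem a b c d) (ℤD.∣m∣n⇒∣m+n x y))
    where
    lem : ∀ a b c d → (a - b) + (c - d) ≡ (a + c) - (b + d)
    lem = solve-∀

  *-cong : ∀ {a b c d} → a ≈ b → c ≈ d → a * c ≈ b * d
  *-cong {a} {b} {c} {d} (mod x) (mod y) =
    mod (≡.subst (ι p ℤD.∣_) (lem a b c d) (ℤD.∣m∣n⇒∣m+n (ℤD.∣m⇒∣m*n c x) (ℤD.∣n⇒∣m*n b y)))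
    where
    lem : ∀ a b c d → (a - b) * c + b * (c - d) ≡ a * c - b * d
    lem = solve-∀

  -‿cong : ∀ {a b} → a ≈ b → - a ≈ - b
  -‿cong {a} {b} (mod x) = mod (≡.subst (ι p ℤD.∣_) (lem a b) (ℤD.∣m⇒∣-m x))
    where
    lem : ∀ a b → - (a - b) ≡ - a - - b
    lem = solve-∀

  +-congˡ : ∀ a {b c} → b ≈ c → a + b ≈ a + c
  +-congˡ a = +-cong (refl {a})

  +-congʳ : ∀ a {b c} → b ≈ c → b + a ≈ c + a
  +-congʳ a e = +-cong e (refl {a})

  *-congˡ : ∀ a {b c} → b ≈ c → a * b ≈ a * c
  *-congˡ a = *-cong (refl {a})

  *-congʳ : ∀ a {b c} → b ≈ c → b * a ≈ c * a
  *-congʳ a e = *-cong e (refl {a})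

  ^-cong : ∀ {a b} n → a ≈ b → a ^ n ≈ b ^ n
  ^-cong zero    e = refl
  ^-cong (suc n) e = *-cong e (^-cong n e)

  sum-cong : ∀ {f g : Seq} n → (∀ i → i < n → f i ≈ g i) → sum f n ≈ sum g n
  sum-cong zero    e = refl
  sum-cong (suc n) e = +-cong (sum-cong n (λ i i<n → e i (ℕₚ.m<n⇒m<1+n i<n))) (e n (ℕₚ.n<1+n n))

  sum-≈0 : ∀ {f : Seq} n → (∀ i → i < n → f i ≈ 0ℤ) → sum f n ≈ 0ℤ
  sum-≈0 n e = trans (sum-cong n e) (≡⇒≈ (sum-zero n))

  sum-single : ∀ {f : Seq} n j → j < n → (∀ i → i < n → ¬ i ≡ j → f i ≈ 0ℤ) → sum f n ≈ f j
  sum-single {f} (suc n) j (s≤s j≤n) e with j ℕ.≟ n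
  ... | yes ≡.refl = trans (+-congʳ (f n) (sum-≈0 n (λ i i<n → e i (ℕₚ.m<n⇒m<1+n i<n) (ℕₚ.<⇒≢ i<n))))
                           (≡⇒≈ (ℤₚ.+-identityˡ (f n)))
  ... | no  j≢n    = trans (+-cong (sum-single n j (ℕₚ.≤∧≢⇒< j≤n j≢n) (λ i i<n → e i (ℕₚ.m<n⇒m<1+n i<n)))
                                   (e n (ℕₚ.n<1+n n) (j≢n ∘ ≡.sym)))
                           (≡⇒≈ (ℤₚ.+-identityʳ (f j)))

  ⊛-cong : ∀ {f f′ g g′ : Seq} n → (∀ i → i ≤ n → f i ≈ f′ i) → (∀ i → i ≤ n → g i ≈ g′ i) →
           (f ⊛ g) n ≈ (f′ ⊛ g′) n
  ⊛-cong zero    e d = *-cong (e 0 z≤n) (d 0 z≤n)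
  ⊛-cong (suc n) e d = +-cong (*-cong (e 0 z≤n) (d (suc n) ℕₚ.≤-refl))
                              (⊛-cong n (λ i i≤n → e (suc i) (s≤s i≤n)) (λ i i≤n → d i (ℕₚ.m≤n⇒m≤1+n i≤n)))

  ⊛-congˡ : ∀ f {g g′ : Seq} n → (∀ i → i ≤ n → g i ≈ g′ i) → (f ⊛ g) n ≈ (f ⊛ g′) n
  ⊛-congˡ f n = ⊛-cong n (λ i _ → refl {f i})

  ⊛-congʳ : ∀ g {f f′ : Seq} n → (∀ i → i ≤ n → f i ≈ f′ i) → (f ⊛ g) n ≈ (f′ ⊛ g) n
  ⊛-congʳ g n e = ⊛-cong n e (λ i _ → refl {g i})

  ∣⇒≈0 : ∀ {n} → p ℕD.∣ n → ι n ≈ 0ℤ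
  ∣⇒≈0 {n} d = mod (ℤD.∣ᵤ⇒∣ (≡.subst (p ℕD.∣_) (≡.cong ℤ.∣_∣ (≡.sym (ℤₚ.+-identityʳ (ι n)))) d))

  ≈0⇒∣ : ∀ {a} → a ≈ 0ℤ → p ℕD.∣ ℤ.∣ a ∣
  ≈0⇒∣ {a} (mod d) = ≡.subst (p ℕD.∣_) (≡.cong ℤ.∣_∣ (ℤₚ.+-identityʳ a)) (ℤD.∣⇒∣ᵤ d)

  ≈0-∣ᵤ : ∀ {a} → p ℕD.∣ ℤ.∣ a ∣ → a ≈ 0ℤ
  ≈0-∣ᵤ {a} d = mod (≡.subst (ι p ℤD.∣_) (≡.sym (ℤₚ.+-identityʳ a)) (ℤD.∣ᵤ⇒∣ d))

  *-≈0 : ∀ a b → a * b ≈ 0ℤ → a ≈ 0ℤ ⊎ b ≈ 0ℤ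
  *-≈0 a b e with euclidsLemma ℤ.∣ a ∣ ℤ.∣ b ∣ pr (≡.subst (p ℕD.∣_) (ℤₚ.abs-* a b) (≈0⇒∣ e))
  ... | inj₁ d = inj₁ (≈0-∣ᵤ d)
  ... | inj₂ d = inj₂ (≈0-∣ᵤ d)

  -≈0⇒≈ : ∀ a b → a - b ≈ 0ℤ → a ≈ b
  -≈0⇒≈ a b (mod d) = mod (≡.subst (ι p ℤD.∣_) (ℤₚ.+-identityʳ (a - b)) d)

  -- Euclid's lemma in the form that replaces division: identities with denominators are multiplied
  -- out and then cancelled.
  *-cancelˡ : ∀ a {b c} → ¬ a ≈ 0ℤ → a * b ≈ a * c → b ≈ c
  *-cancelˡ a {b} {c} a≉0 (mod d)
    with *-≈0 a (b - c) (mod (≡.subst (ι p ℤD.∣_) (lem a b c) d))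
    where
    lem : ∀ a b c → a * b - a * c ≡ a * (b - c) - 0ℤ
    lem = solve-∀
  ... | inj₁ a≈0 = ⊥-elim (a≉0 a≈0)
  ... | inj₂ e   = -≈0⇒≈ b c e

  *-≉0 : ∀ {a b} → ¬ a ≈ 0ℤ → ¬ b ≈ 0ℤ → ¬ a * b ≈ 0ℤ
  *-≉0 {a} {b} x y e = [ x , y ]′ (*-≈0 a b e)

  -- Factorials, Fermat's theorem and inverses modulo p

  1<p : 1 < p
  1<p = ℕ.nonTrivial⇒n>1 p {{prime⇒nonTrivial pr}}

  q : ℕ
  q = p ∸ 1

  p≡1+q : p ≡ suc q
  p≡1+q = ≡.sym (ℕₚ.m+[n∸m]≡n (ℕₚ.<⇒≤ 1<p))

  q≡1+[q∸1] : q ≡ suc (q ∸ 1)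
  q≡1+[q∸1] = ≡.sym (ℕₚ.m+[n∸m]≡n (ℕₚ.≤-pred (≡.subst (2 ≤_) p≡1+q 1<p)))

  q<p : q < p
  q<p = ℕₚ.≤-reflexive (≡.sym p≡1+q)

  <p⇒≤q : ∀ {k} → k < p → k ≤ q
  <p⇒≤q = ℕₚ.≤-pred ∘ ≡.subst (_ <_) p≡1+q

  ≤q⇒<p : ∀ {k} → k ≤ q → k < p
  ≤q⇒<p k≤q = ℕₚ.≤-<-trans k≤q q<p

  ∤-< : ∀ {k} → 0 < k → k < p → ¬ p ℕD.∣ k
  ∤-< 0<k k<p d = ℕₚ.<⇒≱ k<p (ℕD.∣⇒≤ {{ℕ.>-nonZero 0<k}} d)

  ι≉0 : ∀ {k} → ¬ p ℕD.∣ k → ¬ ι k ≈ 0ℤ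
  ι≉0 ¬d e = ¬d (≈0⇒∣ e)

  suc≉0 : ∀ {k} → suc k < p → ¬ ι (suc k) ≈ 0ℤ
  suc≉0 k<p = ι≉0 (∤-< (s≤s z≤n) k<p)

  ∤-! : ∀ {n} → n < p → ¬ p ℕD.∣ n !
  ∤-! {zero}  n<p = ∤-< (s≤s z≤n) 1<p
  ∤-! {suc n} n<p d with euclidsLemma (suc n) (n !) pr d
  ... | inj₁ e = ∤-< (s≤s z≤n) n<p e
  ... | inj₂ e = ∤-! (ℕₚ.<-trans (ℕₚ.n<1+n n) n<p) e

  !≉0 : ∀ {n} → n < p → ¬ ι (n !) ≈ 0ℤ
  !≉0 n<p = ι≉0 (∤-! n<p)

  C-factorial : ∀ {n k} → k ≤ n → (n C k) ℕ.* (k ! ℕ.* (n ∸ k) !) ≡ n !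
  C-factorial {n} {k} k≤n = ≡.trans (≡.cong (ℕ._* (k ! ℕ.* (n ∸ k) !)) (nCk≡n!/k![n-k]! k≤n))
    (m/n*n≡m {{nz}} (≡.subst (ℕD._∣ n !) (ℕₚ.*-comm ((n ∸ k) !) (k !)) ([n∸k]!k!∣n! k≤n)))
    where
    nz = ℕₚ._!*_!≢0 k (n ∸ k)

  C-factorialℤ : ∀ {n k} → k ≤ n → ι (n C k) * (ι (k !) * ι ((n ∸ k) !)) ≡ ι (n !)
  C-factorialℤ {n} {k} k≤n = ≡.trans (≡.cong (ι (n C k) *_) (≡.sym (ℤₚ.pos-* (k !) ((n ∸ k) !))))
    (≡.trans (≡.sym (ℤₚ.pos-* (n C k) _)) (≡.cong ι (C-factorial k≤n)))

  binomial : ∀ x n → (1ℤ + x) ^ n ≡ sum (λ i → ι (n C i) * x ^ i) (suc n)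
  binomial x zero    = ≡.refl
  binomial x (suc n) = R.begin
    (1ℤ + x) * (1ℤ + x) ^ n                                R.≡⟨ ≡.cong ((1ℤ + x) *_) (binomial x n) ⟩
    (1ℤ + x) * sum f (suc n)                               R.≡⟨ lem₁ x (sum f (suc n)) ⟩
    -- The first sum is extended by its vanishing term at i = n + 1. Splitting off index 0 then
    -- gives both sums the same range, and Pascal's rule applies term by term.
    sum f (suc n) + x * sum f (suc n)                      R.≡⟨ ≡.cong₂ _+_ extend (≡.sym (sum-*ˡ x f (suc n))) ⟩
    sum f (suc (suc n)) + sum (λ i → x * f i) (suc n)      R.≡⟨ ≡.cong (_+ sum (λ i → x * f i) (suc n)) (sum-head f (suc n)) ⟩
    f 0 + sum (f ∘ suc) (suc n) + sum (λ i → x * f i) (suc n)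
      R.≡⟨ ℤₚ.+-assoc (f 0) (sum (f ∘ suc) (suc n)) (sum (λ i → x * f i) (suc n)) ⟩
    f 0 + (sum (f ∘ suc) (suc n) + sum (λ i → x * f i) (suc n))
      R.≡⟨ ≡.cong (f 0 +_) (sum-+ (f ∘ suc) (λ i → x * f i) (suc n)) ⟨
    f 0 + sum (λ i → f (suc i) + x * f i) (suc n)
      R.≡⟨ ≡.cong₂ _+_ (≡.cong (λ c → ι c * 1ℤ) (≡.trans (nC0≡1 n) (≡.sym (nC0≡1 (suc n))))) (sum-ext (suc n) (λ i _ → step i)) ⟩
    g 0 + sum (g ∘ suc) (suc n)                            R.≡⟨ sum-head g (suc n) ⟨
    sum g (suc (suc n))                                    R.∎
    where
    module R = ≡.≡-Reasoning
    f g : Seq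
    f i = ι (n C i) * x ^ i
    g i = ι (suc n C i) * x ^ i
    lem₁ : ∀ x s → (1ℤ + x) * s ≡ s + x * s
    lem₁ = solve-∀
    lem₂ : ∀ a b x y → b * (x * y) + x * (a * y) ≡ (a + b) * (x * y)
    lem₂ = solve-∀
    step : ∀ i → f (suc i) + x * f i ≡ g (suc i)
    step i = ≡.trans (lem₂ (ι (n C i)) (ι (n C suc i)) x (x ^ i))
                     (≡.cong (λ c → ι c * (x * x ^ i)) (nCk+nC[k+1]≡[n+1]C[k+1] n i))
    extend : sum f (suc n) ≡ sum f (suc (suc n))
    extend = ≡.trans (≡.sym (ℤₚ.+-identityʳ (sum f (suc n))))
                     (≡.cong (λ c → sum f (suc n) + ι c * x ^ suc n) (≡.sym (k>n⇒nCk≡0 (ℕₚ.n<1+n n))))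

  p∣p! : p ℕD.∣ p !
  p∣p! = ≡.subst (λ n → n ℕD.∣ n !) (≡.sym p≡1+q) (ℕD.m∣m*n (q !))

  -- p divides p! but neither k! nor (p - k)!.
  pCk≈0 : ∀ {k} → 0 < k → k < p → ι (p C k) ≈ 0ℤ
  pCk≈0 {k} 0<k k<p with *-≈0 (ι (p C k)) (ι (k !) * ι ((p ∸ k) !))
         (trans (≡⇒≈ (C-factorialℤ (ℕₚ.<⇒≤ k<p))) (∣⇒≈0 p∣p!))
  ... | inj₁ e = e
  ... | inj₂ e = ⊥-elim (*-≉0 (!≉0 k<p) (!≉0 (ℕₚ.∸-monoʳ-< {o = 0} 0<k (ℕₚ.<⇒≤ k<p))) e)

  fermat : ∀ k → ι k ^ p ≈ ι k
  fermat zero    = ≡⇒≈ (≡.cong (0ℤ ^_) p≡1+q)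
  fermat (suc k) = begin
    (1ℤ + ι k) ^ p                                 ≡⟨ binomial (ι k) p ⟩
    sum f p + f p                                  ≡⟨ ≡.cong (λ n → sum f n + f p) p≡1+q ⟩
    sum f (suc q) + f p                            ≡⟨ ≡.cong (_+ f p) (sum-head f q) ⟩
    f 0 + sum (f ∘ suc) q + f p                    ≈⟨ +-congʳ (f p) (+-congˡ (f 0) (sum-≈0 q middle)) ⟩
    f 0 + 0ℤ + f p                                 ≡⟨ ≡.cong₂ (λ a b → ι a * 1ℤ + 0ℤ + ι b * ι k ^ p) (nC0≡1 p) (nCn≡1 p) ⟩
    1ℤ + 1ℤ * ι k ^ p                              ≈⟨ +-congˡ 1ℤ (*-congˡ 1ℤ (fermat k)) ⟩
    1ℤ + 1ℤ * ι k                                  ≡⟨ ≡.cong (1ℤ +_) (ℤₚ.*-identityˡ (ι k)) ⟩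
    ι (suc k)                                      ∎
    where
    f : Seq
    f i = ι (p C i) * ι k ^ i
    middle : ∀ i → i < q → f (suc i) ≈ 0ℤ
    middle i i<q = *-congʳ (ι k ^ suc i) (pCk≈0 (s≤s z≤n) (≤q⇒<p i<q))

  -- The exponent is p - 2, so by Fermat's theorem this is an integer representative of 1/k when p
  -- does not divide k.
  iv : ℕ → ℤ
  iv k = ι k ^ (q ∸ 1)

  ^q≈1 : ∀ {k} → ¬ p ℕD.∣ k → ι k ^ q ≈ 1ℤ
  ^q≈1 {k} ¬d = *-cancelˡ (ι k) (ι≉0 ¬d) (begin
    ι k ^ suc q  ≡⟨ ≡.cong (ι k ^_) p≡1+q ⟨
    ι k ^ p      ≈⟨ fermat k ⟩
    ι k          ≡⟨ ℤₚ.*-identityʳ (ι k) ⟨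
    ι k * 1ℤ     ∎)

  iv-inverse : ∀ {k} → ¬ p ℕD.∣ k → ι k * iv k ≈ 1ℤ
  iv-inverse {k} ¬d = trans (≡⇒≈ (≡.cong (ι k ^_) (≡.sym q≡1+[q∸1]))) (^q≈1 ¬d)

  ^-distribʳ-* : ∀ a b n → (a * b) ^ n ≡ a ^ n * b ^ n
  ^-distribʳ-* a b zero    = ≡.refl
  ^-distribʳ-* a b (suc n) = ≡.trans (≡.cong (a * b *_) (^-distribʳ-* a b n)) (lem a b (a ^ n) (b ^ n))
    where
    lem : ∀ a b c d → a * b * (c * d) ≡ a * c * (b * d)
    lem = solve-∀

  iv^-inverse : ∀ {k} s → ¬ p ℕD.∣ k → ι k ^ s * iv k ^ s ≈ 1ℤ
  iv^-inverse {k} s ¬d = begin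
    ι k ^ s * iv k ^ s  ≡⟨ ^-distribʳ-* (ι k) (iv k) s ⟨
    (ι k * iv k) ^ s    ≈⟨ ^-cong s (iv-inverse ¬d) ⟩
    1ℤ ^ s              ≡⟨ ℤₚ.^-zeroˡ s ⟩
    1ℤ                  ∎

  sg : ℕ → ℤ
  sg zero    = 1ℤ
  sg (suc n) = - sg n

  sg-+ : ∀ m n → sg (m ℕ.+ n) ≡ sg m * sg n
  sg-+ zero    n = ≡.sym (ℤₚ.*-identityˡ (sg n))
  sg-+ (suc m) n = ≡.trans (≡.cong -_ (sg-+ m n)) (ℤₚ.neg-distribˡ-* (sg m) (sg n))

  sg-² : ∀ n → sg n * sg n ≡ 1ℤ
  sg-² zero    = ≡.refl
  sg-² (suc n) = ≡.trans (lem (sg n)) (sg-² n)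
    where
    lem : ∀ a → - a * - a ≡ a * a
    lem = solve-∀

  neg-^ : ∀ a n → (- a) ^ n ≡ sg n * a ^ n
  neg-^ a zero    = ≡.refl
  neg-^ a (suc n) = ≡.trans (≡.cong (- a *_) (neg-^ a n)) (lem a (sg n) (a ^ n))
    where
    lem : ∀ a b c → - a * (b * c) ≡ - b * (a * c)
    lem = solve-∀

  -- L s k is k^(−s) modulo p, and 0 when p divides k.
  L : ℕ → Seq
  L s k = if does (p ℕD.∣? k) then 0ℤ else iv k ^ s

  L-∣ : ∀ s {k} → p ℕD.∣ k → L s k ≡ 0ℤ
  L-∣ s {k} d with p ℕD.∣? k
  ... | yes _ = ≡.refl
  ... | no ¬d = ⊥-elim (¬d d)

  L-∤ : ∀ s {k} → ¬ p ℕD.∣ k → L s k ≡ iv k ^ s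
  L-∤ s {k} ¬d with p ℕD.∣? k
  ... | yes d = ⊥-elim (¬d d)
  ... | no _  = ≡.refl

  L-0 : ∀ s → L s 0 ≡ 0ℤ
  L-0 s = L-∣ s (p ℕD.∣0)

  L-p : ∀ s → L s p ≡ 0ℤ
  L-p s = L-∣ s ℕD.∣-refl

  L₀≡1 : ∀ {k} → 0 < k → k < p → L 0 k ≡ 1ℤ
  L₀≡1 0<k k<p = L-∤ 0 (∤-< 0<k k<p)

  θ-L : ∀ s k → θ (L (suc s)) k ≈ L s k
  θ-L s k with p ℕD.∣? k
  ... | yes d = ≡⇒≈ (ℤₚ.*-zeroʳ (ι k))
  ... | no ¬d = begin
    ι k * (iv k * iv k ^ s)   ≡⟨ ℤₚ.*-assoc (ι k) (iv k) (iv k ^ s) ⟨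
    ι k * iv k * iv k ^ s     ≈⟨ *-congʳ (iv k ^ s) (iv-inverse ¬d) ⟩
    1ℤ * iv k ^ s             ≡⟨ ℤₚ.*-identityˡ (iv k ^ s) ⟩
    iv k ^ s                  ∎

  L-* : ∀ s t k → L s k * L t k ≡ L (s ℕ.+ t) k
  L-* s t k with p ℕD.∣? k
  ... | yes d = ≡.refl
  ... | no ¬d = ≡.sym (ℤₚ.^-distribˡ-+-* (iv k) s t)

  -- Multiplying by k^q, which is 1 modulo p, makes the exponent -s nonnegative, so that sums of
  -- `L s` become power sums. Since s < q the new exponent is positive, and k = 0 fits too.
  L-pow : ∀ {s k} → s < q → k < p → L s k ≈ ι k ^ (q ∸ s)
  L-pow {s} {zero} s<q k<p = trans (≡⇒≈ (L-0 s)) (≡⇒≈ (≡.cong (0ℤ ^_) (≡.sym (n<m⇒m∸n≡1+[m∸1+n] s<q))))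
  L-pow {s} {k@(suc _)} s<q k<p = begin
    L s k                              ≡⟨ L-∤ s p∤k ⟩
    iv k ^ s                           ≡⟨ ℤₚ.*-identityˡ (iv k ^ s) ⟨
    1ℤ * iv k ^ s                      ≈⟨ *-congʳ (iv k ^ s) (^q≈1 p∤k) ⟨
    ι k ^ q * iv k ^ s                 ≡⟨ ≡.cong (λ n → ι k ^ n * iv k ^ s) (ℕₚ.m∸n+n≡m (ℕₚ.<⇒≤ s<q)) ⟨
    ι k ^ (q ∸ s ℕ.+ s) * iv k ^ s     ≡⟨ ≡.cong (_* iv k ^ s) (ℤₚ.^-distribˡ-+-* (ι k) (q ∸ s) s) ⟩
    ι k ^ (q ∸ s) * ι k ^ s * iv k ^ s ≡⟨ ℤₚ.*-assoc (ι k ^ (q ∸ s)) (ι k ^ s) (iv k ^ s) ⟩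
    ι k ^ (q ∸ s) * (ι k ^ s * iv k ^ s) ≈⟨ *-congˡ (ι k ^ (q ∸ s)) (iv^-inverse s p∤k) ⟩
    ι k ^ (q ∸ s) * 1ℤ                 ≡⟨ ℤₚ.*-identityʳ (ι k ^ (q ∸ s)) ⟩
    ι k ^ (q ∸ s)                      ∎
    where
    p∤k = ∤-< (s≤s z≤n) k<p

  ι-p∸ : ∀ {u} → u ≤ p → ι (p ∸ u) ≈ - ι u
  ι-p∸ {u} u≤p = begin
    ι (p ∸ u)     ≡⟨ ℤₚ.⊖-≥ u≤p ⟨
    p ℤ.⊖ u       ≡⟨ ℤₚ.m-n≡m⊖n p u ⟨
    ι p - ι u     ≈⟨ +-congʳ (- ι u) (∣⇒≈0 ℕD.∣-refl) ⟩
    0ℤ - ι u      ≡⟨ ℤₚ.+-identityˡ (- ι u) ⟩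
    - ι u         ∎

  -- Inverses are unique modulo p, so the inverse of p - u is minus that of u.
  L-reflect : ∀ s {u} → u ≤ p → L s (p ∸ u) ≈ sg s * L s u
  L-reflect s {u} u≤p with p ℕD.∣? u
  ... | yes d = ≡⇒≈ (≡.trans (L-∣ s (ℕD.∣m+n∣m⇒∣n (≡.subst (p ℕD.∣_) (≡.sym (ℕₚ.m+[n∸m]≡n u≤p)) ℕD.∣-refl) d)) (≡.sym (ℤₚ.*-zeroʳ (sg s))))
  ... | no ¬d = begin
    L s (p ∸ u)         ≡⟨ L-∤ s ¬d′ ⟩
    iv (p ∸ u) ^ s      ≈⟨ ^-cong s iv-neg ⟩
    (- iv u) ^ s        ≡⟨ neg-^ (iv u) s ⟩
    sg s * iv u ^ s     ∎
    where
    ¬d′ : ¬ p ℕD.∣ p ∸ u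
    ¬d′ d = ¬d (≈0⇒∣ (begin
      ι u           ≡⟨ ℤₚ.neg-involutive (ι u) ⟨
      - (- ι u)     ≈⟨ -‿cong (ι-p∸ u≤p) ⟨
      - ι (p ∸ u)   ≈⟨ -‿cong (∣⇒≈0 d) ⟩
      0ℤ            ∎))
    lem : ∀ a b → - a * - b ≡ a * b
    lem = solve-∀
    iv-neg : iv (p ∸ u) ≈ - iv u
    iv-neg = *-cancelˡ (ι (p ∸ u)) (ι≉0 ¬d′) (begin
      ι (p ∸ u) * iv (p ∸ u)   ≈⟨ iv-inverse ¬d′ ⟩
      1ℤ                       ≈⟨ iv-inverse ¬d ⟨
      ι u * iv u               ≡⟨ lem (ι u) (iv u) ⟨
      - ι u * - iv u           ≈⟨ *-congʳ (- iv u) (ι-p∸ u≤p) ⟨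
      ι (p ∸ u) * - iv u       ∎)

  -- Bernoulli numbers and power sums

  -- E a is e^(aX), meaningful in degrees below p only.
  E : ℤ → Seq
  E a zero    = 1ℤ
  E a (suc n) = a * E a n * iv (suc n)

  E-cong : ∀ {a b} n → a ≈ b → E a n ≈ E b n
  E-cong zero    e = refl
  E-cong (suc n) e = *-congʳ (iv (suc n)) (*-cong e (E-cong n e))

  E-scale : ∀ a n → E a n ≡ a ^ n * E 1ℤ n
  E-scale a zero    = ≡.refl
  E-scale a (suc n) = ≡.trans (≡.cong (λ z → a * z * iv (suc n)) (E-scale a n)) (lem a (a ^ n) (E 1ℤ n) (iv (suc n)))
    where
    lem : ∀ a b c d → a * (b * c) * d ≡ a * b * (1ℤ * c * d)
    lem = solve-∀

  θ-E : ∀ a {n} → suc n < p → θ (E a) (suc n) ≈ a * E a n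
  θ-E a {n} n<p = begin
    ι (suc n) * (a * E a n * iv (suc n))   ≡⟨ lem (ι (suc n)) (a * E a n) (iv (suc n)) ⟩
    ι (suc n) * iv (suc n) * (a * E a n)   ≈⟨ *-congʳ (a * E a n) (iv-inverse (∤-< (s≤s z≤n) n<p)) ⟩
    1ℤ * (a * E a n)                       ≡⟨ ℤₚ.*-identityˡ (a * E a n) ⟩
    a * E a n                              ∎
    where
    lem : ∀ a b c → a * (b * c) ≡ a * c * b
    lem = solve-∀

  E-factorial : ∀ a {n} → n < p → ι (n !) * E a n ≈ a ^ n
  E-factorial a {zero}  n<p = refl
  E-factorial a {suc n} n<p = begin
    ι (suc n ℕ.* n !) * E a (suc n)      ≡⟨ ≡.cong (_* E a (suc n)) (ℤₚ.pos-* (suc n) (n !)) ⟩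
    ι (suc n) * ι (n !) * E a (suc n)    ≡⟨ lem (ι (suc n)) (ι (n !)) (E a (suc n)) ⟩
    ι (n !) * θ (E a) (suc n)            ≈⟨ *-congˡ (ι (n !)) (θ-E a n<p) ⟩
    ι (n !) * (a * E a n)                ≡⟨ lem₂ (ι (n !)) a (E a n) ⟩
    a * (ι (n !) * E a n)                ≈⟨ *-congˡ a (E-factorial a (ℕₚ.<-trans (ℕₚ.n<1+n n) n<p)) ⟩
    a * a ^ n                            ∎
    where
    lem : ∀ a b c → a * b * c ≡ b * (a * c)
    lem = solve-∀
    lem₂ : ∀ a b c → a * (b * c) ≡ b * (a * c)
    lem₂ = solve-∀

  E₁-factorial : ∀ {n} → n < p → ι (n !) * E 1ℤ n ≈ 1ℤ
  E₁-factorial {n} n<p = trans (E-factorial 1ℤ n<p) (≡⇒≈ (ℤₚ.^-zeroˡ n))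

  -- The differential equation θ e^(aX) = aX e^(aX), multiplied by `f`; the factor X is the drop
  -- from n + 1 to n.
  θE-⊛ : ∀ a f {n} → suc n < p → (θ (E a) ⊛ f) (suc n) ≈ a * (E a ⊛ f) n
  θE-⊛ a f {n} n<p = begin
    0ℤ * 1ℤ * f (suc n) + ((θ (E a) ∘ suc) ⊛ f) n
      ≈⟨ +-congˡ (0ℤ * 1ℤ * f (suc n)) (⊛-congʳ f n (λ i i≤n → θ-E a (ℕₚ.≤-<-trans (s≤s i≤n) n<p))) ⟩
    0ℤ * f (suc n) + ((λ i → a * E a i) ⊛ f) n   ≡⟨ ℤₚ.+-identityˡ _ ⟩
    ((λ i → a * E a i) ⊛ f) n                    ≡⟨ ⊛-*ˡ a (E a) f n ⟩
    a * (E a ⊛ f) n                              ∎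

  -- Both sides satisfy (n+1) uₙ₊₁ = (a+b) uₙ.
  E-⊛ : ∀ a b {n} → n < p → (E a ⊛ E b) n ≈ E (a + b) n
  E-⊛ a b {zero}  n<p = refl
  E-⊛ a b {suc n} n<p = *-cancelˡ (ι (suc n)) (suc≉0 n<p) (begin
    θ (E a ⊛ E b) (suc n)                              ≡⟨ θ-⊛ (E a) (E b) (suc n) ⟩
    (θ (E a) ⊛ E b) (suc n) + (E a ⊛ θ (E b)) (suc n)  ≡⟨ ≡.cong ((θ (E a) ⊛ E b) (suc n) +_) (⊛-comm (E a) (θ (E b)) (suc n)) ⟩
    (θ (E a) ⊛ E b) (suc n) + (θ (E b) ⊛ E a) (suc n)  ≈⟨ +-cong (θE-⊛ a (E b) n<p) (θE-⊛ b (E a) n<p) ⟩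
    a * (E a ⊛ E b) n + b * (E b ⊛ E a) n              ≡⟨ ≡.cong (λ z → a * (E a ⊛ E b) n + b * z) (⊛-comm (E b) (E a) n) ⟩
    a * (E a ⊛ E b) n + b * (E a ⊛ E b) n              ≡⟨ ℤₚ.*-distribʳ-+ ((E a ⊛ E b) n) a b ⟨
    (a + b) * (E a ⊛ E b) n                            ≈⟨ *-congˡ (a + b) (E-⊛ a b (ℕₚ.<-trans (ℕₚ.n<1+n n) n<p)) ⟩
    (a + b) * E (a + b) n                              ≈⟨ θ-E (a + b) n<p ⟨
    ι (suc n) * E (a + b) (suc n)                      ∎)

  E₁-* : ∀ {m i} → i ≤ m → m < p → E 1ℤ i * E 1ℤ (m ∸ i) ≈ E 1ℤ m * ι (m C i)
  E₁-* {m} {i} i≤m m<p = *-cancelˡ (ι (i !) * ι ((m ∸ i) !)) (*-≉0 (!≉0 i<p) (!≉0 m∸i<p)) (begin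
    ι (i !) * ι ((m ∸ i) !) * (E 1ℤ i * E 1ℤ (m ∸ i))     ≡⟨ lem (ι (i !)) (ι ((m ∸ i) !)) (E 1ℤ i) (E 1ℤ (m ∸ i)) ⟩
    ι (i !) * E 1ℤ i * (ι ((m ∸ i) !) * E 1ℤ (m ∸ i))     ≈⟨ *-cong (E₁-factorial i<p) (E₁-factorial m∸i<p) ⟩
    1ℤ                                                     ≈⟨ E₁-factorial m<p ⟨
    ι (m !) * E 1ℤ m                                       ≡⟨ ≡.cong (_* E 1ℤ m) (C-factorialℤ i≤m) ⟨
    ι (m C i) * (ι (i !) * ι ((m ∸ i) !)) * E 1ℤ m         ≡⟨ lem₂ (ι (m C i)) (ι (i !) * ι ((m ∸ i) !)) (E 1ℤ m) ⟩
    ι (i !) * ι ((m ∸ i) !) * (E 1ℤ m * ι (m C i))         ∎)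
    where
    i<p = ℕₚ.≤-<-trans i≤m m<p
    m∸i<p = ℕₚ.≤-<-trans (ℕₚ.m∸n≤m m i) m<p
    lem : ∀ a b c d → a * b * (c * d) ≡ a * c * (b * d)
    lem = solve-∀
    lem₂ : ∀ a b c → a * b * c ≡ b * (c * a)
    lem₂ = solve-∀

  δ X : Seq
  δ zero    = 1ℤ
  δ (suc _) = 0ℤ
  X zero    = 0ℤ
  X (suc n) = δ n

  0-⊛ : ∀ f n → ((λ _ → 0ℤ) ⊛ f) n ≡ 0ℤ
  0-⊛ f zero    = ≡.refl
  0-⊛ f (suc n) = ≡.trans (ℤₚ.+-identityˡ _) (0-⊛ f n)

  δ-⊛ : ∀ f n → (δ ⊛ f) n ≡ f n
  δ-⊛ f zero    = ℤₚ.*-identityˡ (f 0)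
  δ-⊛ f (suc n) = ≡.trans (≡.cong₂ _+_ (ℤₚ.*-identityˡ (f (suc n))) (0-⊛ f n)) (ℤₚ.+-identityʳ (f (suc n)))

  X-⊛ : ∀ f n → (X ⊛ f) (suc n) ≡ f n
  X-⊛ f n = ≡.trans (ℤₚ.+-identityˡ _) (δ-⊛ f n)

  -- Mordell–Tornheim sums

  -- The array is determined by its two edges, and by `pathSum-rec` the right-hand side obeys the
  -- same recurrence. The bound N confines the recurrence to the range in which the exponent N ∸ (a
  -- + b) of the application is a true difference. The corner (0, 0) lies on neither edge sum, hence
  -- 0 < a + b.
  pathSum-unique : ∀ N (j : ℕ → ℕ → ℤ) →
    (∀ a b → suc a ℕ.+ suc b ≤ N → j (suc a) (suc b) ≈ j a (suc b) + j (suc a) b) →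
    ∀ a b → 0 < a ℕ.+ b → a ℕ.+ b ≤ N →
    j a b ≈ pathSum (λ x → j x 0) a b + pathSum (j 0) b a
  pathSum-unique N j rec (suc a) zero _ _ =
    sym (≡⇒≈ (≡.trans (ℤₚ.+-identityʳ (pathSum (λ x → j x 0) (suc a) 0)) (pathSum-0 (λ x → j x 0) a)))
  pathSum-unique N j rec zero (suc b) _ _ =
    sym (≡⇒≈ (≡.trans (ℤₚ.+-identityˡ (pathSum (j 0) (suc b) 0)) (pathSum-0 (j 0) b)))
  pathSum-unique N j rec (suc a) (suc b) _ le = begin
    j (suc a) (suc b)               ≈⟨ rec a b le ⟩
    j a (suc b) + j (suc a) b       ≈⟨ +-cong (pathSum-unique N j rec a (suc b) (ℕₚ.m≤n⇒m≤o+n a (s≤s z≤n)) (ℕₚ.<⇒≤ le))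
                                              (pathSum-unique N j rec (suc a) b (s≤s z≤n) (ℕₚ.<⇒≤ (≡.subst (_≤ N) (ℕₚ.+-suc (suc a) b) le))) ⟩
    pathSum f a (suc b) + pathSum g (suc b) a + (pathSum f (suc a) b + pathSum g b (suc a))
      ≡⟨ lem (pathSum f a (suc b)) (pathSum g (suc b) a) (pathSum f (suc a) b) (pathSum g b (suc a)) ⟩
    pathSum f a (suc b) + pathSum f (suc a) b + (pathSum g b (suc a) + pathSum g (suc b) a)
      ≡⟨ ≡.cong₂ _+_ (pathSum-rec f a b) (pathSum-rec g b a) ⟨
    pathSum f (suc a) (suc b) + pathSum g (suc b) (suc a) ∎
    where
    f g : ℕ → ℤ
    f x = j x 0
    g = j 0
    lem : ∀ a b c d → a + b + (c + d) ≡ a + c + (d + b)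
    lem = solve-∀

  -- The points met by the recurrence: it is applied only where no coordinate is 0 and lowers a
  -- single coordinate, so it stops on a face before it can reach an axis.
  data AtMostOneZero : ℕ → ℕ → ℕ → Set where
    none   : ∀ {a b c} → AtMostOneZero (suc a) (suc b) (suc c)
    first  : ∀ {b c} → AtMostOneZero 0 (suc b) (suc c)
    second : ∀ {a c} → AtMostOneZero (suc a) 0 (suc c)
    third  : ∀ {a b} → AtMostOneZero (suc a) (suc b) 0

  -- Each of the three faces contributes one path sum. On a face itself, two of these vanish because
  -- a range is empty, and the third collapses to the boundary value.
  pathSum₂-unique : ∀ N (j : ℕ → ℕ → ℕ → ℤ) →
    (∀ a b c → suc a ℕ.+ suc b ℕ.+ suc c ≤ N →
       j (suc a) (suc b) (suc c) ≈ j a (suc b) (suc c) + j (suc a) b (suc c) + j (suc a) (suc b) c) →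
    ∀ a b c → AtMostOneZero a b c → a ℕ.+ b ℕ.+ c ≤ N →
    j a b c ≈ pathSum₂ (λ x y → j x y 0) a b c + pathSum₂ (λ x y → j x 0 y) a c b + pathSum₂ (j 0) b c a
  pathSum₂-unique N j rec = go
    where
    f g h : ℕ → ℕ → ℤ
    f x y = j x y 0
    g x y = j x 0 y
    h = j 0
    T : ℕ → ℕ → ℕ → ℤ
    T a b c = pathSum₂ f a b c + pathSum₂ g a c b + pathSum₂ h b c a
    first? : ∀ a {b c} → AtMostOneZero a (suc b) (suc c)
    first? zero    = first
    first? (suc _) = none
    second? : ∀ {a} b {c} → AtMostOneZero (suc a) b (suc c)
    second? zero    = second
    second? (suc _) = none
    third? : ∀ {a b} c → AtMostOneZero (suc a) (suc b) c
    third? zero    = third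
    third? (suc _) = none
    lem : ∀ a b c d e f g h i → (a + b + c) + (d + e + f) + (g + h + i) ≡ (a + d + g) + (b + h + e) + (f + i + c)
    lem = solve-∀
    go : ∀ a b c → AtMostOneZero a b c → a ℕ.+ b ℕ.+ c ≤ N → j a b c ≈ T a b c
    go zero (suc b) (suc c) first _ = sym (≡⇒≈ (≡.trans (ℤₚ.+-identityˡ (pathSum₂ h (suc b) (suc c) 0)) (pathSum₂-0 h b c)))
    go (suc a) zero (suc c) second _ = sym (≡⇒≈ (≡.trans
      (≡.cong (λ z → z + pathSum₂ g (suc a) (suc c) 0 + 0ℤ) (pathSum₂-empty f (suc a) (suc c)))
      (≡.trans (ℤₚ.+-identityʳ (0ℤ + pathSum₂ g (suc a) (suc c) 0))
        (≡.trans (ℤₚ.+-identityˡ (pathSum₂ g (suc a) (suc c) 0)) (pathSum₂-0 g a c)))))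
    go (suc a) (suc b) zero third _ = sym (≡⇒≈ (≡.trans
      (≡.cong₂ (λ y z → pathSum₂ f (suc a) (suc b) 0 + y + z)
        (pathSum₂-empty g (suc a) (suc b)) (pathSum₂-empty h (suc b) (suc a)))
      (≡.trans (ℤₚ.+-identityʳ (pathSum₂ f (suc a) (suc b) 0 + 0ℤ))
        (≡.trans (ℤₚ.+-identityʳ (pathSum₂ f (suc a) (suc b) 0)) (pathSum₂-0 f a b)))))
    go (suc a) (suc b) (suc c) none le = begin
      j (suc a) (suc b) (suc c)
        ≈⟨ rec a b c le ⟩
      j a (suc b) (suc c) + j (suc a) b (suc c) + j (suc a) (suc b) c
        ≈⟨ +-cong (+-cong (go a (suc b) (suc c) (first? a) (ℕₚ.<⇒≤ le))
                          (go (suc a) b (suc c) (second? b) (ℕₚ.<⇒≤ (≡.subst (_≤ N) (≡.cong (ℕ._+ suc c) (ℕₚ.+-suc (suc a) b)) le))))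
                  (go (suc a) (suc b) c (third? c) (ℕₚ.<⇒≤ (≡.subst (_≤ N) (ℕₚ.+-suc (suc a ℕ.+ suc b) c) le))) ⟩
      T a (suc b) (suc c) + T (suc a) b (suc c) + T (suc a) (suc b) c
        ≡⟨ lem (pathSum₂ f a (suc b) (suc c)) (pathSum₂ g a (suc c) (suc b)) (pathSum₂ h (suc b) (suc c) a)
               (pathSum₂ f (suc a) b (suc c)) (pathSum₂ g (suc a) (suc c) b) (pathSum₂ h b (suc c) (suc a))
               (pathSum₂ f (suc a) (suc b) c) (pathSum₂ g (suc a) c (suc b)) (pathSum₂ h (suc b) c (suc a)) ⟩
      (pathSum₂ f a (suc b) (suc c) + pathSum₂ f (suc a) b (suc c) + pathSum₂ f (suc a) (suc b) c)
      + (pathSum₂ g a (suc c) (suc b) + pathSum₂ g (suc a) c (suc b) + pathSum₂ g (suc a) (suc c) b)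
      + (pathSum₂ h b (suc c) (suc a) + pathSum₂ h (suc b) c (suc a) + pathSum₂ h (suc b) (suc c) a)
        ≡⟨ ≡.cong₂ _+_ (≡.cong₂ _+_ (pathSum₂-rec f a b c) (pathSum₂-rec g a c b)) (pathSum₂-rec h b c a) ⟨
      T (suc a) (suc b) (suc c) ∎

  ⊛-+ʳ : ∀ f g g′ n → (f ⊛ (λ i → g i + g′ i)) n ≡ (f ⊛ g) n + (f ⊛ g′) n
  ⊛-+ʳ f g g′ n = ≡.trans (⊛-comm f (λ i → g i + g′ i) n) (≡.trans (⊛-+ˡ g g′ f n) (≡.cong₂ _+_ (⊛-comm g f n) (⊛-comm g′ f n)))

  -- 1/(ij) = (1/i + 1/j)/(i+j), as a statement on convolutions.
  θ-L⊛L : ∀ a b u → θ (L (suc a) ⊛ L (suc b)) u ≈ (L a ⊛ L (suc b)) u + (L (suc a) ⊛ L b) u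
  θ-L⊛L a b u = begin
    θ (L (suc a) ⊛ L (suc b)) u                                          ≡⟨ θ-⊛ (L (suc a)) (L (suc b)) u ⟩
    (θ (L (suc a)) ⊛ L (suc b)) u + (L (suc a) ⊛ θ (L (suc b))) u
      ≈⟨ +-cong (⊛-congʳ (L (suc b)) u (λ i _ → θ-L a i)) (⊛-congˡ (L (suc a)) u (λ i _ → θ-L b i)) ⟩
    (L a ⊛ L (suc b)) u + (L (suc a) ⊛ L b) u                            ∎

  θ-L⊛L⊛L : ∀ a b c u → θ (L (suc a) ⊛ (L (suc b) ⊛ L (suc c))) u ≈
    (L a ⊛ (L (suc b) ⊛ L (suc c))) u + (L (suc a) ⊛ (L b ⊛ L (suc c))) u + (L (suc a) ⊛ (L (suc b) ⊛ L c)) u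
  θ-L⊛L⊛L a b c u = begin
    θ (A ⊛ (B ⊛ C)) u                        ≡⟨ θ-⊛ A (B ⊛ C) u ⟩
    (θ A ⊛ (B ⊛ C)) u + (A ⊛ θ (B ⊛ C)) u
      ≈⟨ +-cong (⊛-congʳ (B ⊛ C) u (λ i _ → θ-L a i)) (⊛-congˡ A u (λ i _ → θ-L⊛L b c i)) ⟩
    (L a ⊛ (B ⊛ C)) u + (A ⊛ (λ i → (L b ⊛ C) i + (B ⊛ L c) i)) u
      ≡⟨ ≡.cong ((L a ⊛ (B ⊛ C)) u +_) (⊛-+ʳ A (L b ⊛ C) (B ⊛ L c) u) ⟩
    (L a ⊛ (B ⊛ C)) u + ((A ⊛ (L b ⊛ C)) u + (A ⊛ (B ⊛ L c)) u)
      ≡⟨ ℤₚ.+-assoc ((L a ⊛ (B ⊛ C)) u) ((A ⊛ (L b ⊛ C)) u) ((A ⊛ (B ⊛ L c)) u) ⟨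
    (L a ⊛ (B ⊛ C)) u + (A ⊛ (L b ⊛ C)) u + (A ⊛ (B ⊛ L c)) u ∎
    where
    A = L (suc a)
    B = L (suc b)
    C = L (suc c)

  -- A factor u is borrowed from u^(-m) = u · u^(-m-1) and handed to `f`, on which it acts as θ.
  -- This is the exchange of exponents that keeps the weight constant.
  *-L≈θ-* : ∀ (f : Seq) m u → f u * L m u ≈ θ f u * L (suc m) u
  *-L≈θ-* f m u = begin
    f u * L m u                    ≈⟨ *-congˡ (f u) (θ-L m u) ⟨
    f u * (ι u * L (suc m) u)      ≡⟨ lem (f u) (ι u) (L (suc m) u) ⟩
    ι u * f u * L (suc m) u        ∎
    where
    lem : ∀ a b c → a * (b * c) ≡ b * a * c
    lem = solve-∀

  -- With exponent 0 the second index j is weighted by 1, so i + j = u says no more than i < u.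
  ⊛-L₀ : ∀ f {u} → u < p → (f ⊛ L 0) u ≈ sum f u
  ⊛-L₀ f {zero}  _   = ≡⇒≈ (≡.trans (≡.cong (f 0 *_) (L-0 0)) (ℤₚ.*-zeroʳ (f 0)))
  ⊛-L₀ f {suc u} u<p = begin
    (f ⊛ L 0) (suc u)                          ≡⟨ ⊛-last f (L 0) u ⟩
    (f ⊛ (L 0 ∘ suc)) u + f (suc u) * L 0 0    ≈⟨ +-cong (⊛-congˡ f u (λ i i≤u → ≡⇒≈ (L₀≡1 (s≤s z≤n) (ℕₚ.≤-<-trans (s≤s i≤u) u<p))))
                                                          (≡⇒≈ (≡.trans (≡.cong (f (suc u) *_) (L-0 0)) (ℤₚ.*-zeroʳ (f (suc u))))) ⟩
    (f ⊛ one) u + 0ℤ                           ≡⟨ ℤₚ.+-identityʳ ((f ⊛ one) u) ⟩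
    (f ⊛ one) u                                ≡⟨ ⊛-one f u ⟩
    sum f (suc u)                              ∎

  -- Σ 1/(i^a j^b k^c (i+j+k)^(w−a−b−c)) over i + j + k < p.
  J : ℕ → ℕ → ℕ → ℕ → ℤ
  J w a b c = sum (λ u → (L a ⊛ (L b ⊛ L c)) u * L (w ∸ (a ℕ.+ b ℕ.+ c)) u) p

  J-rec : ∀ w a b c → suc a ℕ.+ suc b ℕ.+ suc c ≤ w →
    J w (suc a) (suc b) (suc c) ≈ J w a (suc b) (suc c) + J w (suc a) b (suc c) + J w (suc a) (suc b) c
  J-rec w a b c le = begin
    sum (λ u → F u * L m u) p
      ≈⟨ sum-cong p (λ u _ → trans (*-L≈θ-* F m u) (*-congʳ (L (suc m) u) (θ-L⊛L⊛L a b c u))) ⟩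
    sum (λ u → (F₁ u + F₂ u + F₃ u) * L (suc m) u) p
      ≡⟨ sum-ext p (λ u _ → lem (F₁ u) (F₂ u) (F₃ u) (L (suc m) u)) ⟩
    sum (λ u → F₁ u * L (suc m) u + F₂ u * L (suc m) u + F₃ u * L (suc m) u) p
      ≡⟨ sum-+ (λ u → F₁ u * L (suc m) u + F₂ u * L (suc m) u) (λ u → F₃ u * L (suc m) u) p ⟩
    sum (λ u → F₁ u * L (suc m) u + F₂ u * L (suc m) u) p + sum (λ u → F₃ u * L (suc m) u) p
      ≡⟨ ≡.cong (_+ sum (λ u → F₃ u * L (suc m) u) p) (sum-+ (λ u → F₁ u * L (suc m) u) (λ u → F₂ u * L (suc m) u) p) ⟩
    sum (λ u → F₁ u * L (suc m) u) p + sum (λ u → F₂ u * L (suc m) u) p + sum (λ u → F₃ u * L (suc m) u) p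
      ≡⟨ ≡.cong₂ _+_ (≡.cong₂ _+_ (weight F₁ ≡.refl) (weight F₂ (≡.cong (ℕ._+ suc c) (ℕₚ.+-suc (suc a) b))))
                     (weight F₃ (ℕₚ.+-suc (suc a ℕ.+ suc b) c)) ⟩
    J w a (suc b) (suc c) + J w (suc a) b (suc c) + J w (suc a) (suc b) c ∎
    where
    n = suc a ℕ.+ suc b ℕ.+ suc c
    m = w ∸ n
    F F₁ F₂ F₃ : Seq
    F  = L (suc a) ⊛ (L (suc b) ⊛ L (suc c))
    F₁ = L a ⊛ (L (suc b) ⊛ L (suc c))
    F₂ = L (suc a) ⊛ (L b ⊛ L (suc c))
    F₃ = L (suc a) ⊛ (L (suc b) ⊛ L c)
    lem : ∀ a b c d → (a + b + c) * d ≡ a * d + b * d + c * d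
    lem = solve-∀
    weight : ∀ f {n′} → n ≡ suc n′ → sum (λ u → f u * L (suc m) u) p ≡ sum (λ u → f u * L (w ∸ n′) u) p
    weight f {n′} e = sum-ext p (λ u _ → ≡.cong (λ k → f u * L k u)
      (≡.sym (≡.trans (n<m⇒m∸n≡1+[m∸1+n] (≡.subst (_≤ w) e le)) (≡.cong (λ k → suc (w ∸ k)) (≡.sym e)))))

  -- The three exponents may be permuted. Moving a zero to the last place lets one boundary
  -- evaluation serve all three faces.
  J-middle : ∀ w a c → J w a 0 c ≈ J w a c 0
  J-middle w a c = sum-cong p (λ u _ → *-cong
    (⊛-congˡ (L a) u (λ i _ → ≡⇒≈ (⊛-comm (L 0) (L c) i)))
    (≡⇒≈ (≡.cong (λ n → L (w ∸ n) u) (≡.trans (≡.cong (ℕ._+ c) (ℕₚ.+-identityʳ a)) (≡.sym (ℕₚ.+-identityʳ (a ℕ.+ c)))))))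

  J-first : ∀ w b c → J w 0 b c ≈ J w b c 0
  J-first w b c = ≡⇒≈ (sum-ext p (λ u _ → ≡.cong₂ (λ x n → x * L (w ∸ n) u)
    (≡.trans (⊛-comm (L 0) (L b ⊛ L c) u) (⊛-assoc (L b) (L c) (L 0) u))
    (≡.sym (ℕₚ.+-identityʳ (b ℕ.+ c)))))

  -- Eliminating k₄ = p − (k₁+k₂+k₃) produces the sign (−1)^λ.
  L⊛⁴-value : ∀ α β γ l → (L α ⊛ (L β ⊛ (L γ ⊛ (L l ⊛ δ)))) p ≈ sg l * J (α ℕ.+ β ℕ.+ γ ℕ.+ l) α β γ
  L⊛⁴-value α β γ l = begin
    (L α ⊛ (L β ⊛ (L γ ⊛ (L l ⊛ δ)))) p
      ≈⟨ ⊛-congˡ (L α) p (λ i _ → ⊛-congˡ (L β) i (λ j _ → ⊛-congˡ (L γ) j (λ k _ →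
           ≡⇒≈ (≡.trans (⊛-comm (L l) δ k) (δ-⊛ (L l) k))))) ⟩
    (L α ⊛ (L β ⊛ (L γ ⊛ L l))) p
      ≈⟨ ⊛-congˡ (L α) p (λ i _ → ≡⇒≈ (≡.sym (⊛-assoc (L β) (L γ) (L l) i))) ⟩
    (L α ⊛ ((L β ⊛ L γ) ⊛ L l)) p
      ≡⟨ ⊛-assoc (L α) (L β ⊛ L γ) (L l) p ⟨
    (F ⊛ L l) p
      ≡⟨ ⊛-sum F (L l) p ⟩
    sum (λ u → F u * L l (p ∸ u)) (suc p)
      ≈⟨ sum-cong (suc p) (λ u u<1+p → trans (*-congˡ (F u) (L-reflect l (ℕₚ.≤-pred u<1+p))) (≡⇒≈ (lem (F u) (sg l) (L l u)))) ⟩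
    sum (λ u → sg l * (F u * L l u)) (suc p)
      ≡⟨ sum-*ˡ (sg l) (λ u → F u * L l u) (suc p) ⟩
    sg l * (sum (λ u → F u * L l u) p + F p * L l p)
      ≡⟨ ≡.cong (λ z → sg l * (sum (λ u → F u * L l u) p + z)) (≡.trans (≡.cong (F p *_) (L-p l)) (ℤₚ.*-zeroʳ (F p))) ⟩
    sg l * (sum (λ u → F u * L l u) p + 0ℤ)
      ≡⟨ ≡.cong (sg l *_) (ℤₚ.+-identityʳ (sum (λ u → F u * L l u) p)) ⟩
    sg l * sum (λ u → F u * L l u) p
      ≡⟨ ≡.cong (λ k → sg l * sum (λ u → F u * L k u) p) (ℕₚ.m+n∸m≡n (α ℕ.+ β ℕ.+ γ) l) ⟨
    sg l * J (α ℕ.+ β ℕ.+ γ ℕ.+ l) α β γ ∎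
    where
    F = L α ⊛ (L β ⊛ L γ)
    lem : ∀ a b c → a * (b * c) ≡ b * (a * c)
    lem = solve-∀

  hZ : ℕ → ℕ → ℕ → ℤ
  hZ x y z = iv (2 ℕ.* m) * (sg x * ι (m C x) - sg z * ι (m C z))
    where m = x ℕ.+ y ℕ.+ z

  tZ : ℕ → ℕ → ℕ → ℤ
  tZ x y z = sum (λ s → ι ((s ℕ.+ y ∸ 1) C s) * hZ (x ∸ s) (y ℕ.+ s) z) x
           + sum (λ s → ι ((s ℕ.+ x ∸ 1) C s) * hZ (y ∸ s) (x ℕ.+ s) z) y

  -- Stated for any integer sequence obeying the Bernoulli recursion modulo p. The recursion is
  -- assumed while n + 2 < p, the range in which the divisors n + 2 are prime to p.
  module Bernoulli (b : Seq) (b₀ : b 0 ≈ 1ℤ)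
    (b-rec : ∀ n → 2 ℕ.+ n < p → sum (λ k → ι ((2 ℕ.+ n) C k) * b k) (2 ℕ.+ n) ≈ 0ℤ) where

    β : Seq
    β n = b n * E 1ℤ n

    -- The generating function X/(e^X − 1) of β satisfies β e^X = β + X.
    β-⊛-E₁ : ∀ {m} → m < p → (β ⊛ E 1ℤ) m ≈ β m + X m
    β-⊛-E₁ {zero} m<p = ≡⇒≈ (lem (b 0))
      where
      lem : ∀ a → a * 1ℤ * 1ℤ ≡ a * 1ℤ + 0ℤ
      lem = solve-∀
    -- Degree 1 is the only one to which X contributes; from degree 2 on, the recursion of `b`
    -- decides.
    β-⊛-E₁ {suc zero} m<p = begin
      β 0 * E 1ℤ 1 + β 1 * 1ℤ     ≡⟨ ≡.cong (λ z → b 0 * 1ℤ * (1ℤ * z) + β 1 * 1ℤ) (ℤₚ.^-zeroˡ (q ∸ 1)) ⟩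
      b 0 * 1ℤ * 1ℤ + β 1 * 1ℤ    ≈⟨ +-congʳ (β 1 * 1ℤ) (*-congʳ 1ℤ (*-congʳ 1ℤ b₀)) ⟩
      1ℤ + β 1 * 1ℤ               ≡⟨ lem (β 1) ⟩
      β 1 + 1ℤ                    ∎
      where
      lem : ∀ a → 1ℤ + a * 1ℤ ≡ a + 1ℤ
      lem = solve-∀
    β-⊛-E₁ {m@(suc (suc n))} m<p = begin
      (β ⊛ E 1ℤ) m                                        ≡⟨ ⊛-sum β (E 1ℤ) m ⟩
      sum (λ i → β i * E 1ℤ (m ∸ i)) m + β m * E 1ℤ (m ∸ m)
        ≡⟨ ≡.cong (λ j → sum (λ i → β i * E 1ℤ (m ∸ i)) m + β m * E 1ℤ j) (ℕₚ.n∸n≡0 m) ⟩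
      sum (λ i → β i * E 1ℤ (m ∸ i)) m + β m * 1ℤ         ≈⟨ +-congʳ (β m * 1ℤ) (sum-cong m term) ⟩
      sum (λ i → E 1ℤ m * (ι (m C i) * b i)) m + β m * 1ℤ ≡⟨ ≡.cong (_+ β m * 1ℤ) (sum-*ˡ (E 1ℤ m) (λ i → ι (m C i) * b i) m) ⟩
      E 1ℤ m * sum (λ i → ι (m C i) * b i) m + β m * 1ℤ   ≈⟨ +-congʳ (β m * 1ℤ) (*-congˡ (E 1ℤ m) (b-rec n m<p)) ⟩
      E 1ℤ m * 0ℤ + β m * 1ℤ                              ≡⟨ lem (E 1ℤ m) (β m) ⟩
      β m + 0ℤ                                            ∎
      where
      lem : ∀ a c → a * 0ℤ + c * 1ℤ ≡ c + 0ℤ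
      lem = solve-∀
      lem₂ : ∀ a c d → a * (c * d) ≡ c * (d * a)
      lem₂ = solve-∀
      term : ∀ i → i < m → β i * E 1ℤ (m ∸ i) ≈ E 1ℤ m * (ι (m C i) * b i)
      term i i<m = begin
        b i * E 1ℤ i * E 1ℤ (m ∸ i)     ≡⟨ ℤₚ.*-assoc (b i) (E 1ℤ i) (E 1ℤ (m ∸ i)) ⟩
        b i * (E 1ℤ i * E 1ℤ (m ∸ i))   ≈⟨ *-congˡ (b i) (E₁-* (ℕₚ.<⇒≤ i<m) m<p) ⟩
        b i * (E 1ℤ m * ι (m C i))      ≡⟨ lem₂ (b i) (E 1ℤ m) (ι (m C i)) ⟩
        E 1ℤ m * (ι (m C i) * b i)      ∎

    -- Induction on k: replacing e^(kX) by e^X e^(kX) turns the factor β into β + X, which adds the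
    -- new summand X e^(kX).
    β-⊛-E : ∀ k {n} → suc n < p → (β ⊛ E (ι k)) (suc n) ≈ β (suc n) + sum (λ j → E (ι j) n) k
    β-⊛-E zero {n} n<p = begin
      (β ⊛ E 0ℤ) (suc n)   ≡⟨ ⊛-comm β (E 0ℤ) (suc n) ⟩
      (E 0ℤ ⊛ β) (suc n)   ≈⟨ ⊛-congʳ β (suc n) (λ i _ → ≡⇒≈ (E₀ i)) ⟩
      (δ ⊛ β) (suc n)      ≡⟨ δ-⊛ β (suc n) ⟩
      β (suc n)            ≡⟨ ℤₚ.+-identityʳ (β (suc n)) ⟨
      β (suc n) + 0ℤ       ∎
      where
      E₀ : ∀ i → E 0ℤ i ≡ δ i
      E₀ zero    = ≡.refl
      E₀ (suc i) = ≡.refl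
    β-⊛-E (suc k) {n} n<p = begin
      (β ⊛ E (1ℤ + ι k)) m               ≈⟨ ⊛-congˡ β m (λ i i≤m → sym (E-⊛ 1ℤ (ι k) (ℕₚ.≤-<-trans i≤m n<p))) ⟩
      (β ⊛ (E 1ℤ ⊛ E (ι k))) m           ≡⟨ ⊛-assoc β (E 1ℤ) (E (ι k)) m ⟨
      ((β ⊛ E 1ℤ) ⊛ E (ι k)) m           ≈⟨ ⊛-congʳ (E (ι k)) m (λ i i≤m → β-⊛-E₁ (ℕₚ.≤-<-trans i≤m n<p)) ⟩
      ((λ i → β i + X i) ⊛ E (ι k)) m    ≡⟨ ⊛-+ˡ β X (E (ι k)) m ⟩
      (β ⊛ E (ι k)) m + (X ⊛ E (ι k)) m  ≈⟨ +-cong (β-⊛-E k n<p) (≡⇒≈ (X-⊛ (E (ι k)) n)) ⟩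
      β m + sum (λ j → E (ι j) n) k + E (ι k) n  ≡⟨ ℤₚ.+-assoc (β m) (sum (λ j → E (ι j) n) k) (E (ι k) n) ⟩
      β m + (sum (λ j → E (ι j) n) k + E (ι k) n)  ∎
      where m = suc n

    -- The term i = n + 1 of the product in `β-⊛-E` cancels β (n + 1) on the other side; what
    -- remains is a polynomial in k without constant term.
    faulhaber : ∀ k {n} → suc n < p →
      sum (λ j → E (ι j) n) k ≈ sum (λ i → β i * E (ι k) (suc n ∸ i)) (suc n)
    faulhaber k {n} n<p = begin
      s                              ≡⟨ lem (β (suc n)) s ⟩
      (β (suc n) + s) - β (suc n)    ≈⟨ +-congʳ (- β (suc n)) (β-⊛-E k n<p) ⟨
      (β ⊛ E (ι k)) (suc n) - β (suc n)  ≡⟨ ≡.cong (_- β (suc n)) (⊛-sum β (E (ι k)) (suc n)) ⟩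
      s′ + β (suc n) * E (ι k) (n ∸ n) - β (suc n)  ≡⟨ ≡.cong (λ j → s′ + β (suc n) * E (ι k) j - β (suc n)) (ℕₚ.n∸n≡0 n) ⟩
      s′ + β (suc n) * 1ℤ - β (suc n)               ≡⟨ lem₂ s′ (β (suc n)) ⟩
      s′                             ∎
      where
      s = sum (λ j → E (ι j) n) k
      s′ = sum (λ i → β i * E (ι k) (suc n ∸ i)) (suc n)
      lem : ∀ a c → c ≡ (a + c) - a
      lem = solve-∀
      lem₂ : ∀ a c → a + c * 1ℤ - c ≡ a
      lem₂ = solve-∀

    ^-as-E : ∀ k {n} → n < p → sum (λ j → ι j ^ n) k ≈ ι (n !) * sum (λ j → E (ι j) n) k
    ^-as-E k {n} n<p = begin
      sum (λ j → ι j ^ n) k                  ≈⟨ sum-cong k (λ j _ → sym (E-factorial (ι j) n<p)) ⟩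
      sum (λ j → ι (n !) * E (ι j) n) k      ≡⟨ sum-*ˡ (ι (n !)) (λ j → E (ι j) n) k ⟩
      ι (n !) * sum (λ j → E (ι j) n) k      ∎

    -- A polynomial without constant term vanishes modulo p at k = p; n < q keeps the degree n + 1
    -- below p.
    sum-^≈0 : ∀ {n} → n < q → sum (λ j → ι j ^ n) p ≈ 0ℤ
    sum-^≈0 {n} n<q = begin
      sum (λ j → ι j ^ n) p                  ≈⟨ ^-as-E p (≤q⇒<p (ℕₚ.<⇒≤ n<q)) ⟩
      ι (n !) * sum (λ j → E (ι j) n) p      ≈⟨ *-congˡ (ι (n !)) (faulhaber p (≤q⇒<p n<q)) ⟩
      ι (n !) * sum (λ i → β i * E (ι p) (suc n ∸ i)) (suc n)  ≈⟨ *-congˡ (ι (n !)) (sum-≈0 (suc n) term) ⟩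
      ι (n !) * 0ℤ                           ≡⟨ ℤₚ.*-zeroʳ (ι (n !)) ⟩
      0ℤ                                     ∎
      where
      term : ∀ i → i < suc n → β i * E (ι p) (suc n ∸ i) ≈ 0ℤ
      term i i<n = begin
        β i * E (ι p) (suc n ∸ i)   ≈⟨ *-congˡ (β i) (E-cong (suc n ∸ i) (∣⇒≈0 ℕD.∣-refl)) ⟩
        β i * E 0ℤ (suc n ∸ i)      ≡⟨ ≡.cong (λ j → β i * E 0ℤ j) (n<m⇒m∸n≡1+[m∸1+n] i<n) ⟩
        β i * 0ℤ                    ≡⟨ ℤₚ.*-zeroʳ (β i) ⟩
        0ℤ                          ∎

    sum-L≈0 : ∀ {m} → 0 < m → m < q → sum (L m) p ≈ 0ℤ
    sum-L≈0 {m} 0<m m<q = trans (sum-cong p (λ k k<p → L-pow m<q k<p))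
      (sum-^≈0 (ℕₚ.∸-monoʳ-< {o = 0} 0<m (ℕₚ.<⇒≤ m<q)))

    ^-*-L : ∀ e m k → ι k ^ e * L (e ℕ.+ m) k ≈ L m k
    ^-*-L zero    m k = ≡⇒≈ (ℤₚ.*-identityˡ (L m k))
    ^-*-L (suc e) m k = begin
      ι k * ι k ^ e * L (suc (e ℕ.+ m)) k   ≡⟨ lem (ι k) (ι k ^ e) (L (suc (e ℕ.+ m)) k) ⟩
      ι k ^ e * θ (L (suc (e ℕ.+ m))) k     ≈⟨ *-congˡ (ι k ^ e) (θ-L (e ℕ.+ m) k) ⟩
      ι k ^ e * L (e ℕ.+ m) k               ≈⟨ ^-*-L e m k ⟩
      L m k                                 ∎
      where
      lem : ∀ a c d → a * c * d ≡ c * (a * d)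
      lem = solve-∀

    sum-L₀ : sum (L 0) p ≈ - 1ℤ
    sum-L₀ = begin
      sum (L 0) p              ≡⟨ ≡.cong (sum (L 0)) p≡1+q ⟩
      sum (L 0) (suc q)        ≡⟨ sum-head (L 0) q ⟩
      L 0 0 + sum (L 0 ∘ suc) q  ≡⟨ ≡.cong₂ _+_ (L-0 0) (sum-ext q (λ i i<q → L₀≡1 (s≤s z≤n) (≤q⇒<p i<q))) ⟩
      0ℤ + sum one q           ≡⟨ ≡.cong (0ℤ +_) (sum-one q) ⟩
      0ℤ + ι q                 ≡⟨ ℤₚ.+-identityˡ (ι q) ⟩
      ι (p ∸ 1)                ≈⟨ ι-p∸ (ℕₚ.<⇒≤ 1<p) ⟩
      - 1ℤ                     ∎
      where
      sum-one : ∀ n → sum one n ≡ ι n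
      sum-one zero    = ≡.refl
      sum-one (suc n) = ≡.trans (≡.cong (_+ 1ℤ) (sum-one n)) (≡.cong ι (ℕₚ.+-comm n 1))

    sum-^L-diag : ∀ t → sum (λ k → ι k ^ t * L t k) p ≈ - 1ℤ
    sum-^L-diag t = trans (sum-cong p (λ k _ → trans
      (≡⇒≈ (≡.cong (λ u → ι k ^ t * L u k) (≡.sym (ℕₚ.+-identityʳ t)))) (^-*-L t 0 k))) sum-L₀

    -- A power sum over the nonzero residues can differ from 0 only if p - 1 divides the net
    -- exponent e - t; the bounds put e - t strictly between -q and q, and 0 is excluded.
    sum-^L-off : ∀ {e t} → e < q ℕ.+ t → t < q → ¬ e ≡ t → sum (λ k → ι k ^ e * L t k) p ≈ 0ℤ
    sum-^L-off {e} {t} e<q+t t<q e≢t with ℕₚ.<-cmp e t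
    ... | tri≈ _ e≡t _ = ⊥-elim (e≢t e≡t)
    ... | tri< e<t _ _ = trans
      (sum-cong p (λ k _ → trans
        (≡⇒≈ (≡.cong (λ u → ι k ^ e * L u k) (≡.sym (ℕₚ.m+[n∸m]≡n (ℕₚ.<⇒≤ e<t))))) (^-*-L e (t ∸ e) k)))
      (sum-L≈0 (ℕₚ.m<n⇒0<n∸m e<t) (ℕₚ.≤-<-trans (ℕₚ.m∸n≤m t e) t<q))
    ... | tri> _ _ e>t = trans (sum-cong p term)
      (sum-^≈0 (ℕₚ.+-cancelʳ-< t (e ∸ t) q (≡.subst (_< q ℕ.+ t) (≡.sym (ℕₚ.m∸n+n≡m (ℕₚ.<⇒≤ e>t))) e<q+t)))
      where
      d = e ∸ t
      0^n : ∀ {n} → 0 < n → 0ℤ ^ n ≡ 0ℤ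
      0^n (s≤s _) = ≡.refl
      -- At k = 0 the cut-off `L 0` is 0 instead of 1, but 0^d is 0 as well because d > 0.
      drop-L₀ : ∀ k → k < p → ι k ^ d * L 0 k ≈ ι k ^ d
      drop-L₀ zero      k<p = ≡⇒≈ (≡.trans (≡.cong (_* L 0 0) 0^d) (≡.sym 0^d))
        where
        0^d = 0^n (ℕₚ.m<n⇒0<n∸m e>t)
      drop-L₀ k@(suc _) k<p = ≡⇒≈ (≡.trans (≡.cong (ι k ^ d *_) (L₀≡1 (s≤s z≤n) k<p)) (ℤₚ.*-identityʳ (ι k ^ d)))
      term : ∀ k → k < p → ι k ^ e * L t k ≈ ι k ^ d
      term k k<p = begin
        ι k ^ e * L t k              ≡⟨ ≡.cong (λ n → ι k ^ n * L t k) (ℕₚ.m∸n+n≡m (ℕₚ.<⇒≤ e>t)) ⟨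
        ι k ^ (d ℕ.+ t) * L t k      ≡⟨ ≡.cong (_* L t k) (ℤₚ.^-distribˡ-+-* (ι k) d t) ⟩
        ι k ^ d * ι k ^ t * L t k    ≡⟨ ℤₚ.*-assoc (ι k ^ d) (ι k ^ t) (L t k) ⟩
        ι k ^ d * (ι k ^ t * L t k)  ≡⟨ ≡.cong (λ u → ι k ^ d * (ι k ^ t * L u k)) (ℕₚ.+-identityʳ t) ⟨
        ι k ^ d * (ι k ^ t * L (t ℕ.+ 0) k)  ≈⟨ *-congˡ (ι k ^ d) (^-*-L t 0 k) ⟩
        ι k ^ d * L 0 k              ≈⟨ drop-L₀ k k<p ⟩
        ι k ^ d                      ∎

    -- Double harmonic sums

    H₂ : ℕ → ℕ → ℤ
    H₂ s t = sum (L s ⋆ L t) p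

    sum-L-faulhaber : ∀ {s k} → 0 < s → s < q → k < p →
      sum (L s) k ≈ ι ((q ∸ s) !) * sum (λ i → β i * E (ι k) (suc (q ∸ s) ∸ i)) (suc (q ∸ s))
    sum-L-faulhaber {s} {k} 0<s s<q k<p = begin
      sum (L s) k                         ≈⟨ sum-cong k (λ j j<k → L-pow s<q (ℕₚ.<-trans j<k k<p)) ⟩
      sum (λ j → ι j ^ (q ∸ s)) k         ≈⟨ ^-as-E k (≤q⇒<p (ℕₚ.m∸n≤m q s)) ⟩
      ι ((q ∸ s) !) * sum (λ j → E (ι j) (q ∸ s)) k
        ≈⟨ *-congˡ (ι ((q ∸ s) !)) (faulhaber k (≤q⇒<p (ℕₚ.∸-monoʳ-< {o = 0} 0<s (ℕₚ.<⇒≤ s<q)))) ⟩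
      ι ((q ∸ s) !) * sum (λ i → β i * E (ι k) (suc (q ∸ s) ∸ i)) (suc (q ∸ s)) ∎

    -- In the polynomial for the inner sum, k^e has the coefficient index n + 1 - e, so the
    -- surviving e = t carries β at p - s - t. The factor -1 is the number p - 1 of terms in the
    -- surviving sum.
    H₂-β : ∀ {s t} → 0 < s → 0 < t → s ℕ.+ t ≤ q →
      H₂ s t ≈ ι ((q ∸ s) !) * (β (suc (q ∸ s) ∸ t) * (E 1ℤ t * - 1ℤ))
    H₂-β {s} {t} 0<s 0<t s+t≤q = begin
      sum (λ k → sum (L s) k * L t k) p
        ≈⟨ sum-cong p (λ k k<p → *-congʳ (L t k) (sum-L-faulhaber 0<s s<q k<p)) ⟩
      sum (λ k → c * sum (λ i → β i * E (ι k) (suc n ∸ i)) (suc n) * L t k) p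
        ≡⟨ sum-ext p (λ k _ → ≡.trans (ℤₚ.*-assoc c _ (L t k))
             (≡.cong (c *_) (≡.sym (sum-*ʳ (λ i → β i * E (ι k) (suc n ∸ i)) (L t k) (suc n))))) ⟩
      sum (λ k → c * sum (λ i → β i * E (ι k) (suc n ∸ i) * L t k) (suc n)) p
        ≡⟨ sum-*ˡ c (λ k → sum (λ i → β i * E (ι k) (suc n ∸ i) * L t k) (suc n)) p ⟩
      c * sum (λ k → sum (λ i → β i * E (ι k) (suc n ∸ i) * L t k) (suc n)) p
        ≡⟨ ≡.cong (c *_) (sum-swap (λ k i → β i * E (ι k) (suc n ∸ i) * L t k) p (suc n)) ⟩
      c * sum (λ i → sum (λ k → β i * E (ι k) (suc n ∸ i) * L t k) p) (suc n)
        ≡⟨ ≡.cong (c *_) (sum-ext (suc n) (λ i _ → inner i)) ⟩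
      c * sum (λ i → β i * (E 1ℤ (suc n ∸ i) * M (suc n ∸ i))) (suc n)
        ≈⟨ *-congˡ c (sum-single (suc n) j j<1+n other) ⟩
      c * (β j * (E 1ℤ (suc n ∸ j) * M (suc n ∸ j)))
        ≡⟨ ≡.cong (λ u → c * (β j * (E 1ℤ u * M u))) (ℕₚ.m∸[m∸n]≡n t≤1+n) ⟩
      c * (β j * (E 1ℤ t * M t))
        ≈⟨ *-congˡ c (*-congˡ (β j) (*-congˡ (E 1ℤ t) (sum-^L-diag t))) ⟩
      c * (β j * (E 1ℤ t * - 1ℤ)) ∎
      where
      n = q ∸ s
      c = ι (n !)
      j = suc n ∸ t
      M : ℕ → ℤ
      M e = sum (λ k → ι k ^ e * L t k) p
      s<q : s < q
      s<q = ℕₚ.<-≤-trans (ℕₚ.m<m+n s 0<t) s+t≤q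
      t<q : t < q
      t<q = ℕₚ.<-≤-trans (ℕₚ.m<n+m t 0<s) s+t≤q
      n<q : n < q
      n<q = ℕₚ.∸-monoʳ-< {o = 0} 0<s (ℕₚ.<⇒≤ s<q)
      t≤n : t ≤ n
      t≤n = ≡.subst (_≤ n) (ℕₚ.m+n∸m≡n s t) (ℕₚ.∸-monoˡ-≤ s s+t≤q)
      t≤1+n : t ≤ suc n
      t≤1+n = ℕₚ.m≤n⇒m≤1+n t≤n
      j<1+n : j < suc n
      j<1+n = ℕₚ.∸-monoʳ-< {o = 0} 0<t t≤1+n
      lem : ∀ a b c d → a * (b * c) * d ≡ a * c * (b * d)
      lem = solve-∀
      inner : ∀ i → sum (λ k → β i * E (ι k) (suc n ∸ i) * L t k) p ≡ β i * (E 1ℤ (suc n ∸ i) * M (suc n ∸ i))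
      inner i = ≡.trans
        (sum-ext p (λ k _ → ≡.trans (≡.cong (λ z → β i * z * L t k) (E-scale (ι k) e)) (lem (β i) (ι k ^ e) (E 1ℤ e) (L t k))))
        (≡.trans (sum-*ˡ (β i * E 1ℤ e) (λ k → ι k ^ e * L t k) p) (ℤₚ.*-assoc (β i) (E 1ℤ e) (M e)))
        where e = suc n ∸ i
      other : ∀ i → i < suc n → ¬ i ≡ j → β i * (E 1ℤ (suc n ∸ i) * M (suc n ∸ i)) ≈ 0ℤ
      other i i<1+n i≢j = begin
        β i * (E 1ℤ e * M e)  ≈⟨ *-congˡ (β i) (*-congˡ (E 1ℤ e) (sum-^L-off e<q+t t<q e≢t)) ⟩
        β i * (E 1ℤ e * 0ℤ)   ≡⟨ lem₂ (β i) (E 1ℤ e) ⟩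
        0ℤ                    ∎
        where
        e = suc n ∸ i
        lem₂ : ∀ a b → a * (b * 0ℤ) ≡ 0ℤ
        lem₂ = solve-∀
        e<q+t : e < q ℕ.+ t
        e<q+t = ℕₚ.≤-<-trans (ℕₚ.≤-trans (ℕₚ.m∸n≤m (suc n) i) n<q) (ℕₚ.m<m+n q 0<t)
        e≢t : ¬ e ≡ t
        e≢t e≡t = i≢j (≡.trans (≡.sym (ℕₚ.m∸[m∸n]≡n (ℕₚ.<⇒≤ i<1+n))) (≡.cong (suc n ∸_) e≡t))

    -- A relative of Wilson's theorem: raising s by one removes the factor p - 1 - s from the first
    -- factorial and adds s + 1 to the second, and these two are negatives of each other modulo p.
    !-reflect : ∀ {s} → s ≤ q → ι ((q ∸ s) !) * ι (s !) ≈ sg s * ι (q !)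
    !-reflect {zero}  _   = ≡⇒≈ (ℤₚ.*-comm (ι (q !)) 1ℤ)
    !-reflect {suc s} s<q = begin
      ι (d !) * ι (suc s ℕ.* s !)                ≡⟨ ≡.cong (ι (d !) *_) (ℤₚ.pos-* (suc s) (s !)) ⟩
      ι (d !) * (ι (suc s) * ι (s !))            ≡⟨ lem (ι (d !)) (ι (suc s)) (ι (s !)) ⟩
      - (- ι (suc s) * ι (d !) * ι (s !))        ≈⟨ -‿cong (*-congʳ (ι (s !)) (*-congʳ (ι (d !)) (ι-p∸ (ℕₚ.≤-trans s<q (ℕₚ.<⇒≤ q<p))))) ⟨
      - (ι (p ∸ suc s) * ι (d !) * ι (s !))      ≡⟨ ≡.cong (λ z → - (ι (z ∸ suc s) * ι (d !) * ι (s !))) p≡1+q ⟩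
      - (ι (q ∸ s) * ι (d !) * ι (s !))          ≡⟨ ≡.cong (λ z → - (z * ι (s !))) (≡.trans (≡.sym (ℤₚ.pos-* (q ∸ s) (d !))) (≡.cong ι fact)) ⟩
      - (ι ((q ∸ s) !) * ι (s !))                ≈⟨ -‿cong (!-reflect (ℕₚ.<⇒≤ s<q)) ⟩
      - (sg s * ι (q !))                         ≡⟨ ℤₚ.neg-distribˡ-* (sg s) (ι (q !)) ⟩
      - sg s * ι (q !)                           ∎
      where
      d = q ∸ suc s
      fact : (q ∸ s) ℕ.* d ! ≡ (q ∸ s) !
      fact = ≡.trans (≡.cong (ℕ._* d !) (n<m⇒m∸n≡1+[m∸1+n] s<q)) (≡.cong _! (≡.sym (n<m⇒m∸n≡1+[m∸1+n] s<q)))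
      lem : ∀ a b c → a * (b * c) ≡ - (- b * a * c)
      lem = solve-∀

    -- By `!-reflect` the factorials of q - s and of d = p - w are signed quotients of q! by s! and
    -- by (w - 1)!, so q! drops out; the factor w then completes (w - 1)! to w!. The sign is
    -- -(-1)^(s + w - 1) = (-1)^t.
    H₂-value : ∀ {s t} → 0 < s → 0 < t → s ℕ.+ t ≤ q →
      ι (s ℕ.+ t) * H₂ s t ≈ sg t * ι ((s ℕ.+ t) C s) * b (p ∸ (s ℕ.+ t))
    H₂-value {s@(suc s′)} {t} 0<s 0<t s+t≤q = begin
      ι w * H₂ s t
        ≈⟨ *-congˡ (ι w) (H₂-β 0<s 0<t s+t≤q) ⟩
      ι w * (A * (β (suc (q ∸ s) ∸ t) * (E 1ℤ t * - 1ℤ)))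
        ≡⟨ ≡.cong (λ j → ι w * (A * (β j * (E 1ℤ t * - 1ℤ)))) index ⟩
      ι w * (A * (b d * E 1ℤ d * (E 1ℤ t * - 1ℤ)))
        ≡⟨ lem₁ (ι w) A (b d) (E 1ℤ d) (E 1ℤ t) ⟩
      ι w * - (A * (E 1ℤ d * E 1ℤ t)) * b d
        ≈⟨ *-congʳ (b d) coefficient ⟩
      sg t * ι (w C s) * b d
        ≡⟨ ≡.cong (λ z → sg t * ι (w C s) * b (z ∸ w)) p≡1+q ⟨
      sg t * ι (w C s) * b (p ∸ w) ∎
      where
      w = s ℕ.+ t
      v = s′ ℕ.+ t
      d = q ∸ v
      A = ι ((q ∸ s) !)
      D = ι (d !)
      index : suc (q ∸ s) ∸ t ≡ d
      index = ≡.trans (≡.cong (_∸ t) (≡.sym (n<m⇒m∸n≡1+[m∸1+n] (ℕₚ.≤-trans (ℕₚ.m≤m+n s t) s+t≤q)))) (ℕₚ.∸-+-assoc q s′ t)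
      s≤q = ℕₚ.≤-trans (ℕₚ.m≤m+n s t) s+t≤q
      s<p = ≤q⇒<p s≤q
      t<p = ≤q⇒<p (ℕₚ.≤-trans (ℕₚ.m≤n+m t s) s+t≤q)
      d<p = ≤q⇒<p (ℕₚ.m∸n≤m q v)
      lem₁ : ∀ w a b d t → w * (a * (b * d * (t * - 1ℤ))) ≡ w * - (a * (d * t)) * b
      lem₁ = solve-∀
      lem₂ : ∀ s t d w a e f → s * t * d * (w * - (a * (e * f))) ≡ - w * (a * s) * (t * f) * (d * e)
      lem₂ = solve-∀
      lem₃ : ∀ w x y → - w * (x * y) * 1ℤ * 1ℤ ≡ w * (- x * y)
      lem₃ = solve-∀
      lem₄ : ∀ w a y → w * (a * y) ≡ w * (a * 1ℤ * y)
      lem₄ = solve-∀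
      lem₅ : ∀ w a x y → w * (a * (x * x) * y) ≡ x * w * (a * x * y)
      lem₅ = solve-∀
      lem₆ : ∀ x w d v → x * w * (d * v) ≡ x * (w * v) * d
      lem₆ = solve-∀
      lem₇ : ∀ x c s t d → x * (c * (s * t)) * d ≡ s * t * d * (x * c)
      lem₇ = solve-∀
      coefficient : ι w * - (A * (E 1ℤ d * E 1ℤ t)) ≈ sg t * ι (w C s)
      coefficient = *-cancelˡ (ι (s !) * ι (t !) * D) (*-≉0 (*-≉0 (!≉0 s<p) (!≉0 t<p)) (!≉0 d<p)) (begin
        ι (s !) * ι (t !) * D * (ι w * - (A * (E 1ℤ d * E 1ℤ t)))
          ≡⟨ lem₂ (ι (s !)) (ι (t !)) D (ι w) A (E 1ℤ d) (E 1ℤ t) ⟩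
        - ι w * (A * ι (s !)) * (ι (t !) * E 1ℤ t) * (D * E 1ℤ d)
          ≈⟨ *-cong (*-cong (*-congˡ (- ι w) (!-reflect s≤q)) (E₁-factorial t<p)) (E₁-factorial d<p) ⟩
        - ι w * (sg s * ι (q !)) * 1ℤ * 1ℤ
          ≡⟨ lem₃ (ι w) (sg s) (ι (q !)) ⟩
        ι w * (- sg s * ι (q !))
          ≡⟨ ≡.cong (λ z → ι w * (z * ι (q !))) (ℤₚ.neg-involutive (sg s′)) ⟩
        ι w * (sg s′ * ι (q !))
          ≡⟨ lem₄ (ι w) (sg s′) (ι (q !)) ⟩
        ι w * (sg s′ * 1ℤ * ι (q !))
          ≡⟨ ≡.cong (λ z → ι w * (sg s′ * z * ι (q !))) (sg-² t) ⟨
        ι w * (sg s′ * (sg t * sg t) * ι (q !))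
          ≡⟨ lem₅ (ι w) (sg s′) (sg t) (ι (q !)) ⟩
        sg t * ι w * (sg s′ * sg t * ι (q !))
          ≡⟨ ≡.cong (λ z → sg t * ι w * (z * ι (q !))) (sg-+ s′ t) ⟨
        sg t * ι w * (sg v * ι (q !))
          ≈⟨ *-congˡ (sg t * ι w) (!-reflect (ℕₚ.<⇒≤ s+t≤q)) ⟨
        sg t * ι w * (D * ι (v !))
          ≡⟨ lem₆ (sg t) (ι w) D (ι (v !)) ⟩
        sg t * (ι w * ι (v !)) * D
          ≡⟨ ≡.cong (λ z → sg t * z * D) (ℤₚ.pos-* w (v !)) ⟨
        sg t * ι (w !) * D
          ≡⟨ ≡.cong (λ z → sg t * z * D) (C-factorialℤ (ℕₚ.m≤m+n s t)) ⟨
        sg t * (ι (w C s) * (ι (s !) * ι ((w ∸ s) !))) * D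
          ≡⟨ ≡.cong (λ z → sg t * (ι (w C s) * (ι (s !) * ι (z !))) * D) (ℕₚ.m+n∸m≡n s t) ⟩
        sg t * (ι (w C s) * (ι (s !) * ι (t !))) * D
          ≡⟨ lem₇ (sg t) (ι (w C s)) (ι (s !)) (ι (t !)) D ⟩
        ι (s !) * ι (t !) * D * (sg t * ι (w C s)) ∎)

    -- Triple harmonic sums in odd weight

    -- The full sum vanishes, so the sum over k < p - v is minus its tail, and k ↦ p - k carries the
    -- tail to the indices 1, ..., v. The index v is included: a strict sum becomes a non-strict
    -- one.
    sum-L-reflect : ∀ {s} → 0 < s → s < q → ∀ v → v ≤ p → sum (L s) (p ∸ v) ≈ - (sg s * sum (L s) (suc v))
    sum-L-reflect {s} 0<s s<q zero    _   = begin
      sum (L s) p                  ≈⟨ sum-L≈0 0<s s<q ⟩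
      0ℤ                           ≡⟨ lem (sg s) ⟩
      - (sg s * (0ℤ + 0ℤ))         ≡⟨ ≡.cong (λ z → - (sg s * (0ℤ + z))) (L-0 s) ⟨
      - (sg s * (0ℤ + L s 0))      ∎
      where
      lem : ∀ a → 0ℤ ≡ - (a * (0ℤ + 0ℤ))
      lem = solve-∀
    sum-L-reflect {s} 0<s s<q (suc v) v<p = begin
      sum (L s) d                              ≡⟨ lem (sum (L s) d) (L s d) ⟩
      (sum (L s) d + L s d) - L s d            ≡⟨ ≡.cong (λ z → sum (L s) z - L s d) (n<m⇒m∸n≡1+[m∸1+n] v<p) ⟨
      sum (L s) (p ∸ v) - L s d                ≈⟨ +-cong (sum-L-reflect 0<s s<q v (ℕₚ.<⇒≤ v<p)) (-‿cong (L-reflect s v<p)) ⟩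
      - (sg s * sum (L s) (suc v)) - sg s * L s (suc v)  ≡⟨ lem₂ (sg s) (sum (L s) (suc v)) (L s (suc v)) ⟩
      - (sg s * (sum (L s) (suc v) + L s (suc v)))       ∎
      where
      d = p ∸ suc v
      lem : ∀ a c → a ≡ (a + c) - c
      lem = solve-∀
      lem₂ : ∀ a c d → - (a * c) - a * d ≡ - (a * (c + d))
      lem₂ = solve-∀

    H₃ : ℕ → ℕ → ℕ → ℤ
    H₃ x y z = sum ((L x ⋆ L y) ⋆ L z) p

    module _ {x y z} (0<x : 0 < x) (0<y : 0 < y) (0<z : 0 < z) (w<q : x ℕ.+ y ℕ.+ z < q)
             (odd : sg (x ℕ.+ y ℕ.+ z) ≡ - 1ℤ) where

      private
        w = x ℕ.+ y ℕ.+ z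
        x≤w : x ≤ w
        x≤w = ℕₚ.≤-trans (ℕₚ.m≤m+n x y) (ℕₚ.m≤m+n (x ℕ.+ y) z)
        z≤w : z ≤ w
        z≤w = ℕₚ.m≤n+m z (x ℕ.+ y)
        x<q = ℕₚ.≤-<-trans x≤w w<q
        z<q = ℕₚ.≤-<-trans z≤w w<q
        -- `Q` is the sum over i < v and k < v of i^(-x) v^(-y) k^(-z), with the middle index on
        -- top. Both stuffle and reflection produce it, and it is then eliminated.
        G : Seq
        G v = L y v * (sum (L x) v * sum (L z) v)
        Q = sum G p
        P R : ℤ
        P = H₂ x (y ℕ.+ z)
        R = H₂ z (x ℕ.+ y)

        G-p : G p ≡ 0ℤ
        G-p = ≡.cong (_* (sum (L x) p * sum (L z) p)) (L-p y)

        -- The non-strict sums exceed the strict ones by the diagonals i = v and k = v, which merge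
        -- exponents and yield the terms of `P`, of `R` and, where both occur, of `L w`.
        expand : ∀ v → L y v * (sum (L x) (suc v) * sum (L z) (suc v)) ≡
                       G v + (L x ⋆ L (y ℕ.+ z)) v + (L z ⋆ L (x ℕ.+ y)) v + L w v
        expand v = ≡.trans (lem (L y v) (sum (L x) v) (L x v) (sum (L z) v) (L z v))
          (≡.trans (≡.cong₂ (λ m n → G v + sum (L x) v * m + sum (L z) v * n + n * L z v) (L-* y z v) (L-* x y v))
                   (≡.cong (G v + (L x ⋆ L (y ℕ.+ z)) v + (L z ⋆ L (x ℕ.+ y)) v +_) (L-* (x ℕ.+ y) z v)))
          where
          lem : ∀ y a x c z → y * ((a + x) * (c + z)) ≡ y * (a * c) + a * (y * z) + c * (x * y) + x * y * z
          lem = solve-∀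

        reflect : ∀ v → v ≤ p → G (p ∸ v) ≈ - 1ℤ * (G v + (L x ⋆ L (y ℕ.+ z)) v + (L z ⋆ L (x ℕ.+ y)) v + L w v)
        reflect v v≤p = begin
          L y (p ∸ v) * (sum (L x) (p ∸ v) * sum (L z) (p ∸ v))
            ≈⟨ *-cong (L-reflect y v≤p) (*-cong (sum-L-reflect 0<x x<q v v≤p) (sum-L-reflect 0<z z<q v v≤p)) ⟩
          sg y * L y v * (- (sg x * A) * - (sg z * C′))
            ≡⟨ lem (sg y) (L y v) (sg x) A (sg z) C′ ⟩
          sg x * sg y * sg z * (L y v * (A * C′))
            ≡⟨ ≡.cong (λ s → s * (L y v * (A * C′))) sign ⟩
          - 1ℤ * (L y v * (A * C′))
            ≡⟨ ≡.cong (- 1ℤ *_) (expand v) ⟩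
          - 1ℤ * (G v + (L x ⋆ L (y ℕ.+ z)) v + (L z ⋆ L (x ℕ.+ y)) v + L w v) ∎
          where
          A = sum (L x) (suc v)
          C′ = sum (L z) (suc v)
          lem : ∀ s y t a u c → s * y * (- (t * a) * - (u * c)) ≡ t * s * u * (y * (a * c))
          lem = solve-∀
          sign : sg x * sg y * sg z ≡ - 1ℤ
          sign = ≡.trans (≡.cong (_* sg z) (≡.sym (sg-+ x y))) (≡.trans (≡.sym (sg-+ (x ℕ.+ y) z)) odd)

        -- The substitution v ↦ p - v sends `Q` to its non-strict version, with the sign -1 of the
        -- odd weight; the 0 stands for the vanishing full sum of `L w`.
        Q-reflect : Q ≈ - 1ℤ * (Q + P + R + 0ℤ)
        Q-reflect = begin
          sum G p                              ≡⟨ ℤₚ.+-identityʳ (sum G p) ⟨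
          sum G p + 0ℤ                         ≡⟨ ≡.cong (sum G p +_) G-p ⟨
          sum G (suc p)                        ≡⟨ sum-reverse G p ⟨
          sum (λ v → G (p ∸ v)) (suc p)        ≈⟨ sum-cong (suc p) (λ v v<1+p → reflect v (ℕₚ.≤-pred v<1+p)) ⟩
          sum (λ v → - 1ℤ * F v) (suc p)       ≡⟨ sum-*ˡ (- 1ℤ) F (suc p) ⟩
          - 1ℤ * (sum F p + F p)               ≡⟨ ≡.cong₂ (λ m n → - 1ℤ * (m + n)) sum-F F-p ⟩
          - 1ℤ * (Q + P + R + sum (L w) p + 0ℤ) ≡⟨ ≡.cong (- 1ℤ *_) (ℤₚ.+-identityʳ (Q + P + R + sum (L w) p)) ⟩
          - 1ℤ * (Q + P + R + sum (L w) p)     ≈⟨ *-congˡ (- 1ℤ) (+-congˡ (Q + P + R) (sum-L≈0 (ℕₚ.<-≤-trans 0<x x≤w) w<q)) ⟩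
          - 1ℤ * (Q + P + R + 0ℤ)              ∎
          where
          F₁ F₂ F : Seq
          F₁ v = G v + (L x ⋆ L (y ℕ.+ z)) v
          F₂ v = F₁ v + (L z ⋆ L (x ℕ.+ y)) v
          F v = F₂ v + L w v
          sum-F : sum F p ≡ Q + P + R + sum (L w) p
          sum-F = ≡.trans (sum-+ F₂ (L w) p) (≡.cong (_+ sum (L w) p)
            (≡.trans (sum-+ F₁ (L z ⋆ L (x ℕ.+ y)) p) (≡.cong (_+ R) (sum-+ G (L x ⋆ L (y ℕ.+ z)) p))))
          F-p : F p ≡ 0ℤ
          F-p = ≡.trans (≡.sym (expand p)) (≡.cong (_* (sum (L x) (suc p) * sum (L z) (suc p))) (L-p y))

        -- A double sum over i < j times the vanishing single sum over k; the three terms are k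
        -- above j, k below j and k = j.
        Q-stuffle : 0ℤ ≈ H₃ x y z + Q + P
        Q-stuffle = begin
          0ℤ                                      ≡⟨ ℤₚ.*-zeroʳ (sum (L x ⋆ L y) p) ⟨
          sum (L x ⋆ L y) p * 0ℤ                  ≈⟨ *-congˡ (sum (L x ⋆ L y) p) (sum-L≈0 0<z z<q) ⟨
          sum (L x ⋆ L y) p * sum (L z) p         ≡⟨ stuffle (L x ⋆ L y) (L z) p ⟩
          H₃ x y z + sum (L z ⋆ (L x ⋆ L y)) p + sum (λ v → (L x ⋆ L y) v * L z v) p
            ≡⟨ ≡.cong₂ (λ m n → H₃ x y z + m + n)
                 (sum-ext p (λ v _ → lem (sum (L z) v) (sum (L x) v) (L y v)))
                 (sum-ext p (λ v _ → ≡.trans (ℤₚ.*-assoc (sum (L x) v) (L y v) (L z v)) (≡.cong (sum (L x) v *_) (L-* y z v)))) ⟩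
          H₃ x y z + Q + P                        ∎
          where
          lem : ∀ c a y → c * (a * y) ≡ y * (a * c)
          lem = solve-∀

      -- Eliminates `Q` between 2Q = -P - R and H₃ + Q + P = 0.
      H₃-double : ι 2 * H₃ x y z ≈ R - P
      H₃-double = begin
        ι 2 * H                                            ≡⟨ lem H Q P R ⟩
        ι 2 * (H + Q + P) + (- 1ℤ * (Q + P + R + 0ℤ) - Q) + (R - P)
          ≈⟨ +-congʳ (R - P) (+-cong (*-congˡ (ι 2) (sym Q-stuffle)) (+-congʳ (- Q) (sym Q-reflect))) ⟩
        ι 2 * 0ℤ + (Q - Q) + (R - P)                       ≡⟨ lem₂ Q (R - P) ⟩
        R - P                                              ∎
        where
        H = H₃ x y z
        lem : ∀ h q p r → (1ℤ + 1ℤ) * h ≡ (1ℤ + 1ℤ) * (h + q + p) + (- 1ℤ * (q + p + r + 0ℤ) - q) + (r - p)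
        lem = solve-∀
        lem₂ : ∀ q r → (1ℤ + 1ℤ) * 0ℤ + (q - q) + r ≡ r
        lem₂ = solve-∀

      H₃-value : ι (2 ℕ.* w) * H₃ x y z ≈ (sg x * ι (w C x) - sg z * ι (w C z)) * b (p ∸ w)
      H₃-value = begin
        ι (2 ℕ.* w) * H₃ x y z        ≡⟨ ≡.cong (_* H₃ x y z) (ℤₚ.pos-* 2 w) ⟩
        ι 2 * ι w * H₃ x y z          ≡⟨ lem₁ (ι 2) (ι w) (H₃ x y z) ⟩
        ι w * (ι 2 * H₃ x y z)        ≈⟨ *-congˡ (ι w) H₃-double ⟩
        ι w * (R - P)                 ≡⟨ lem₂ (ι w) R P ⟩
        ι w * R - ι w * P             ≈⟨ +-cong value-R (-‿cong value-P) ⟩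
        - sg z * ι (w C z) * B′ - (- sg x * ι (w C x) * B′)  ≡⟨ lem₃ (sg z) (ι (w C z)) B′ (sg x) (ι (w C x)) ⟩
        (sg x * ι (w C x) - sg z * ι (w C z)) * B′ ∎
        where
        B′ = b (p ∸ w)
        lem₁ : ∀ a b c → a * b * c ≡ b * (a * c)
        lem₁ = solve-∀
        lem₂ : ∀ a b c → a * (b - c) ≡ a * b - a * c
        lem₂ = solve-∀
        lem₃ : ∀ z c b x d → - z * c * b - (- x * d * b) ≡ (x * d - z * c) * b
        lem₃ = solve-∀
        lem₄ : ∀ a → a * - 1ℤ ≡ - a
        lem₄ = solve-∀
        -- `H₂-value` carries the sign of its second exponent. In odd weight this is minus the sign
        -- of the first, which gives the signs in `h`.
        opposite : ∀ m n → m ℕ.+ n ≡ w → sg n ≡ - sg m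
        opposite m n e = ≡.trans (≡.sym (ℤₚ.*-identityˡ (sg n))) (≡.trans (≡.cong (_* sg n) (≡.sym (sg-² m)))
          (≡.trans (ℤₚ.*-assoc (sg m) (sg m) (sg n))
            (≡.trans (≡.cong (sg m *_) (≡.trans (≡.sym (sg-+ m n)) (≡.trans (≡.cong sg e) odd))) (lem₄ (sg m)))))
        value : ∀ m n → 0 < m → 0 < n → m ℕ.+ n ≡ w → ι w * H₂ m n ≈ - sg m * ι (w C m) * B′
        value m n 0<m 0<n e = ≡.subst (λ u → ι u * H₂ m n ≈ - sg m * ι (u C m) * b (p ∸ u)) e
          (trans (H₂-value 0<m 0<n (ℕₚ.≤-trans (ℕₚ.≤-reflexive e) (ℕₚ.<⇒≤ w<q)))
                 (≡⇒≈ (≡.cong (λ s → s * ι ((m ℕ.+ n) C m) * b (p ∸ (m ℕ.+ n))) (opposite m n e))))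
        value-R : ι w * R ≈ - sg z * ι (w C z) * B′
        value-R = value z (x ℕ.+ y) 0<z (ℕₚ.<-≤-trans 0<x (ℕₚ.m≤m+n x y)) (ℕₚ.+-comm z (x ℕ.+ y))
        value-P : ι w * P ≈ - sg x * ι (w C x) * B′
        value-P = value x (y ℕ.+ z) 0<x (ℕₚ.<-≤-trans 0<y (ℕₚ.m≤m+n y z)) (≡.sym (ℕₚ.+-assoc x y z))

    -- From convolutions to triple harmonic sums

    -- Σ 1/(i^x j^y (i+j)^(N−x−y) u^z) over i + j < u < p.
    J₂ : ℕ → ℕ → ℕ → ℕ → ℤ
    J₂ N z x y = sum ((λ v → (L x ⊛ L y) v * L (N ∸ (x ℕ.+ y)) v) ⋆ L z) p

    J₂-rec : ∀ N z x y → suc x ℕ.+ suc y ≤ N → J₂ N z (suc x) (suc y) ≈ J₂ N z x (suc y) + J₂ N z (suc x) y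
    J₂-rec N z x y le = begin
      sum (λ u → sum (λ v → F v * L m v) u * L z u) p
        ≈⟨ sum-cong p (λ u _ → *-congʳ (L z u) (sum-cong u (λ v _ →
             trans (*-L≈θ-* F m v) (*-congʳ (L (suc m) v) (θ-L⊛L x y v))))) ⟩
      sum (λ u → sum (λ v → (F₁ v + F₂ v) * L (suc m) v) u * L z u) p
        ≡⟨ sum-ext p (λ u _ → ≡.trans (≡.cong (_* L z u) (split u))
             (ℤₚ.*-distribʳ-+ (L z u) (sum (V₁ (suc m)) u) (sum (V₂ (suc m)) u))) ⟩
      sum (λ u → sum (V₁ (suc m)) u * L z u + sum (V₂ (suc m)) u * L z u) p
        ≡⟨ sum-+ (V₁ (suc m) ⋆ L z) (V₂ (suc m) ⋆ L z) p ⟩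
      sum (V₁ (suc m) ⋆ L z) p + sum (V₂ (suc m) ⋆ L z) p
        ≡⟨ ≡.cong₂ _+_ (≡.cong (λ k → sum (V₁ k ⋆ L z) p) (≡.sym (n<m⇒m∸n≡1+[m∸1+n] le)))
                       (≡.cong (λ k → sum (V₂ k ⋆ L z) p)
                         (≡.sym (≡.trans (n<m⇒m∸n≡1+[m∸1+n] (≡.subst (_≤ N) e le)) (≡.cong (λ k → suc (N ∸ k)) (≡.sym e))))) ⟩
      J₂ N z x (suc y) + J₂ N z (suc x) y ∎
      where
      m = N ∸ (suc x ℕ.+ suc y)
      e = ℕₚ.+-suc (suc x) y
      F F₁ F₂ : Seq
      F  = L (suc x) ⊛ L (suc y)
      F₁ = L x ⊛ L (suc y)
      F₂ = L (suc x) ⊛ L y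
      V₁ V₂ : ℕ → Seq
      V₁ k v = F₁ v * L k v
      V₂ k v = F₂ v * L k v
      split : ∀ u → sum (λ v → (F₁ v + F₂ v) * L (suc m) v) u ≡ sum (V₁ (suc m)) u + sum (V₂ (suc m)) u
      split u = ≡.trans (sum-ext u (λ v _ → ℤₚ.*-distribʳ-+ (L (suc m) v) (F₁ v) (F₂ v))) (sum-+ (V₁ (suc m)) (V₂ (suc m)) u)

    -- With y = 0 the index j is weighted by 1, so v = i + j runs over all v > i and replaces j as
    -- the middle index.
    J₂-right : ∀ N z x → J₂ N z x 0 ≈ H₃ x (N ∸ x) z
    J₂-right N z x = sum-cong p (λ u u<p → *-congʳ (L z u) (sum-cong u (λ v v<u → *-cong (⊛-L₀ (L x) (ℕₚ.<-trans v<u u<p))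
      (≡⇒≈ (≡.cong (λ k → L (N ∸ k) v) (ℕₚ.+-identityʳ x))))))

    J₂-left : ∀ N z y → J₂ N z 0 y ≈ H₃ y (N ∸ y) z
    J₂-left N z y = sum-cong p (λ u u<p → *-congʳ (L z u) (sum-cong u (λ v v<u → *-congʳ (L (N ∸ y) v)
      (trans (≡⇒≈ (⊛-comm (L 0) (L y) v)) (⊛-L₀ (L y) (ℕₚ.<-trans v<u u<p))))))

    -- The last exponent is 0, so u = i + j + k becomes an index ranging freely above v = i + j. The
    -- exponent of v starts at 0 and grows in the second recurrence.
    J≈J₂ : ∀ w x y → J w x y 0 ≈ J₂ (x ℕ.+ y) (w ∸ (x ℕ.+ y)) x y
    J≈J₂ w x y = sum-cong p (λ u u<p → begin
      (L x ⊛ (L y ⊛ L 0)) u * L (w ∸ (x ℕ.+ y ℕ.+ 0)) u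
        ≡⟨ ≡.cong₂ (λ m n → m * L (w ∸ n) u) (≡.sym (⊛-assoc (L x) (L y) (L 0) u)) (ℕₚ.+-identityʳ (x ℕ.+ y)) ⟩
      ((L x ⊛ L y) ⊛ L 0) u * L (w ∸ (x ℕ.+ y)) u
        ≈⟨ *-congʳ (L (w ∸ (x ℕ.+ y)) u) (⊛-L₀ (L x ⊛ L y) u<p) ⟩
      sum (L x ⊛ L y) u * L (w ∸ (x ℕ.+ y)) u
        ≈⟨ *-congʳ (L (w ∸ (x ℕ.+ y)) u) (sum-cong u (λ v v<u → add-L₀ v (ℕₚ.<-trans v<u u<p))) ⟩
      sum (λ v → (L x ⊛ L y) v * L (x ℕ.+ y ∸ (x ℕ.+ y)) v) u * L (w ∸ (x ℕ.+ y)) u ∎)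
      where
      -- Inserting v^0 as `L 0 v` changes nothing: at v = 0, where `L 0` is 0, the convolution is 0
      -- too.
      add-L₀ : ∀ v → v < p → (L x ⊛ L y) v ≈ (L x ⊛ L y) v * L (x ℕ.+ y ∸ (x ℕ.+ y)) v
      add-L₀ v v<p = ≡⇒≈ (≡.trans (go v v<p) (≡.cong (λ k → (L x ⊛ L y) v * L k v) (≡.sym (ℕₚ.n∸n≡0 (x ℕ.+ y)))))
        where
        go : ∀ v → v < p → (L x ⊛ L y) v ≡ (L x ⊛ L y) v * L 0 v
        go zero      _   = ≡.trans (≡.cong (_* L y 0) (L-0 x)) (≡.cong (λ z → z * L y 0 * L 0 0) (≡.sym (L-0 x)))
        go k@(suc _) k<p = ≡.sym (≡.trans (≡.cong ((L x ⊛ L y) k *_) (L₀≡1 (s≤s z≤n) k<p)) (ℤₚ.*-identityʳ ((L x ⊛ L y) k)))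

    -- Evaluation in a fixed odd weight w

    module Weight (w : ℕ) (2+w<p : w ℕ.+ 2 < p) (odd : sg w ≡ - 1ℤ) where
      w<q : w < q
      w<q = ℕₚ.≤-trans (ℕₚ.m<m+n w (s≤s z≤n)) (<p⇒≤q 2+w<p)

      Bw : ℤ
      Bw = b (p ∸ w)

      p∤2w : 0 < w → ¬ p ℕD.∣ 2 ℕ.* w
      p∤2w 0<w d with euclidsLemma 2 w pr d
      ... | inj₁ e = ∤-< (s≤s z≤n) (ℕₚ.≤-<-trans (ℕₚ.m≤n+m 2 w) 2+w<p) e
      ... | inj₂ e = ∤-< 0<w (≤q⇒<p (ℕₚ.<⇒≤ w<q)) e

      H₃≈hZ : ∀ {x y z} → 0 < x → 0 < y → 0 < z → x ℕ.+ y ℕ.+ z ≡ w → H₃ x y z ≈ hZ x y z * Bw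
      H₃≈hZ {x} {y} {z} 0<x 0<y 0<z ≡.refl = *-cancelˡ (ι (2 ℕ.* w)) (ι≉0 p∤) (begin
        ι (2 ℕ.* w) * H₃ x y z                    ≈⟨ H₃-value 0<x 0<y 0<z w<q odd ⟩
        h * Bw                                    ≡⟨ ≡.cong (_* Bw) (ℤₚ.*-identityˡ h) ⟨
        1ℤ * h * Bw                               ≈⟨ *-congʳ Bw (*-congʳ h (iv-inverse p∤)) ⟨
        ι (2 ℕ.* w) * iv (2 ℕ.* w) * h * Bw       ≡⟨ lem (ι (2 ℕ.* w)) (iv (2 ℕ.* w)) h Bw ⟩
        ι (2 ℕ.* w) * (iv (2 ℕ.* w) * h * Bw)     ∎)
        where
        h = sg x * ι (w C x) - sg z * ι (w C z)
        p∤ = p∤2w (ℕₚ.<-≤-trans 0<z (ℕₚ.m≤n+m z (x ℕ.+ y)))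
        lem : ∀ a b c d → a * b * c * d ≡ a * (b * c * d)
        lem = solve-∀

      pathSum≈hZ : ∀ x y z → 0 < y → 0 < z → x ℕ.+ y ℕ.+ z ≡ w → (f : ℕ → ℤ) → (∀ x′ → f x′ ≈ H₃ x′ (x ℕ.+ y ∸ x′) z) →
        pathSum f x y ≈ sum (λ s → ι ((s ℕ.+ y ∸ 1) C s) * hZ (x ∸ s) (y ℕ.+ s) z) x * Bw
      pathSum≈hZ x y@(suc y′) z 0<y 0<z e f f≈H₃ = begin
        sum (λ s → ι (paths s y) * f (x ∸ s)) x
          ≈⟨ sum-cong x term ⟩
        sum (λ s → ι ((s ℕ.+ y ∸ 1) C s) * hZ (x ∸ s) (y ℕ.+ s) z * Bw) x
          ≡⟨ sum-*ʳ (λ s → ι ((s ℕ.+ y ∸ 1) C s) * hZ (x ∸ s) (y ℕ.+ s) z) Bw x ⟩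
        sum (λ s → ι ((s ℕ.+ y ∸ 1) C s) * hZ (x ∸ s) (y ℕ.+ s) z) x * Bw ∎
        where
        term : ∀ s → s < x → ι (paths s y) * f (x ∸ s) ≈ ι ((s ℕ.+ y ∸ 1) C s) * hZ (x ∸ s) (y ℕ.+ s) z * Bw
        term s s<x = begin
          ι (paths s y) * f (x ∸ s)
            ≈⟨ *-cong (≡⇒≈ (≡.cong ι (≡.trans (paths≡C s y′) (≡.cong (λ n → (n ∸ 1) C s) (≡.sym (ℕₚ.+-suc s y′))))))
                      (f≈H₃ (x ∸ s)) ⟩
          c * H₃ (x ∸ s) (x ℕ.+ y ∸ (x ∸ s)) z
            ≡⟨ ≡.cong (λ n → c * H₃ (x ∸ s) n z) second-index ⟩
          c * H₃ (x ∸ s) (y ℕ.+ s) z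
            ≈⟨ *-congˡ c (H₃≈hZ (ℕₚ.m<n⇒0<n∸m s<x) (s≤s z≤n) 0<z total) ⟩
          c * (hZ (x ∸ s) (y ℕ.+ s) z * Bw)
            ≡⟨ ℤₚ.*-assoc c (hZ (x ∸ s) (y ℕ.+ s) z) Bw ⟨
          c * hZ (x ∸ s) (y ℕ.+ s) z * Bw ∎
          where
          c = ι ((s ℕ.+ y ∸ 1) C s)
          add : x ∸ s ℕ.+ (y ℕ.+ s) ≡ x ℕ.+ y
          add = ≡.trans (lem (x ∸ s) y s) (≡.cong (ℕ._+ y) (ℕₚ.m∸n+n≡m (ℕₚ.<⇒≤ s<x)))
            where
            lem : ∀ a b c → a ℕ.+ (b ℕ.+ c) ≡ a ℕ.+ c ℕ.+ b
            lem = solveℕ-∀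
          second-index : x ℕ.+ y ∸ (x ∸ s) ≡ y ℕ.+ s
          second-index = ≡.trans (≡.cong (_∸ (x ∸ s)) (≡.sym add)) (ℕₚ.m+n∸m≡n (x ∸ s) (y ℕ.+ s))
          total : x ∸ s ℕ.+ (y ℕ.+ s) ℕ.+ z ≡ w
          total = ≡.trans (≡.cong (ℕ._+ z) add) e

      -- The array `J₂ N z` is solved at its extreme point x + y = N; its two edges give the two
      -- sums in `t`.
      J-boundary : ∀ x y → 0 < x → 0 < y → x ℕ.+ y < w → J w x y 0 ≈ tZ x y (w ∸ x ∸ y) * Bw
      J-boundary x y 0<x 0<y x+y<w = begin
        J w x y 0                                     ≈⟨ J≈J₂ w x y ⟩
        J₂ N (w ∸ N) x y                              ≡⟨ ≡.cong (λ z → J₂ N z x y) (ℕₚ.∸-+-assoc w x y) ⟨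
        J₂ N z x y                                    ≈⟨ pathSum-unique N (J₂ N z) (J₂-rec N z) x y
                                                         (ℕₚ.<-≤-trans 0<x (ℕₚ.m≤m+n x y)) ℕₚ.≤-refl ⟩
        pathSum (λ x → J₂ N z x 0) x y + pathSum (J₂ N z 0) y x
          ≈⟨ +-cong (pathSum≈hZ x y z 0<y 0<z total (λ x → J₂ N z x 0) (J₂-right N z))
                    (pathSum≈hZ y x z 0<x 0<z (≡.trans (≡.cong (ℕ._+ z) (ℕₚ.+-comm y x)) total) (J₂ N z 0)
                       (λ y′ → trans (J₂-left N z y′) (≡⇒≈ (≡.cong (λ n → H₃ y′ (n ∸ y′) z) (ℕₚ.+-comm x y))))) ⟩
        S₁ * Bw + S₂ * Bw                             ≡⟨ ℤₚ.*-distribʳ-+ Bw S₁ S₂ ⟨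
        tZ x y z * Bw                                 ∎
        where
        N = x ℕ.+ y
        z = w ∸ x ∸ y
        S₁ = sum (λ s → ι ((s ℕ.+ y ∸ 1) C s) * hZ (x ∸ s) (y ℕ.+ s) z) x
        S₂ = sum (λ s → ι ((s ℕ.+ x ∸ 1) C s) * hZ (y ∸ s) (x ℕ.+ s) z) y
        0<z : 0 < z
        0<z = ≡.subst (0 <_) (≡.sym (ℕₚ.∸-+-assoc w x y)) (ℕₚ.m<n⇒0<n∸m x+y<w)
        total : N ℕ.+ z ≡ w
        total = ≡.trans (≡.cong (N ℕ.+_) (ℕₚ.∸-+-assoc w x y)) (ℕₚ.m+[n∸m]≡n (ℕₚ.<⇒≤ x+y<w))

      -- The residue of one of the three double sums, with each of α, β, γ written as a successor;
      -- `paths₂` at `suc c` is the multinomial coefficient with lower entry c, such as γ - 1.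
      GZ : ℕ → ℕ → ℕ → ℤ
      GZ a b c = sum (λ i → sum (λ j → ι (paths₂ (a ∸ i) (b ∸ j) (suc c)) * tZ (suc i) (suc j) (w ∸ suc i ∸ suc j)) (suc b)) (suc a)

      pathSum₂≈GZ : ∀ a b c → suc a ℕ.+ suc b < w → (f : ℕ → ℕ → ℤ) → (∀ x y → f x y ≈ J w x y 0) →
        pathSum₂ f (suc a) (suc b) (suc c) ≈ GZ a b c * Bw
      pathSum₂≈GZ a b c lt f f≈J = begin
        pathSum₂ f (suc a) (suc b) (suc c)
          ≡⟨ pathSum₂-reverse f a b (suc c) ⟩
        sum (λ i → sum (λ j → M i j * f (suc i) (suc j)) (suc b)) (suc a)
          ≈⟨ sum-cong (suc a) (λ i i≤a → sum-cong (suc b) (λ j j≤b → term i j i≤a j≤b)) ⟩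
        sum (λ i → sum (λ j → M i j * T i j * Bw) (suc b)) (suc a)
          ≡⟨ sum-ext (suc a) (λ i _ → sum-*ʳ (λ j → M i j * T i j) Bw (suc b)) ⟩
        sum (λ i → sum (λ j → M i j * T i j) (suc b) * Bw) (suc a)
          ≡⟨ sum-*ʳ (λ i → sum (λ j → M i j * T i j) (suc b)) Bw (suc a) ⟩
        GZ a b c * Bw ∎
        where
        M T : ℕ → ℕ → ℤ
        M i j = ι (paths₂ (a ∸ i) (b ∸ j) (suc c))
        T i j = tZ (suc i) (suc j) (w ∸ suc i ∸ suc j)
        term : ∀ i j → i < suc a → j < suc b → M i j * f (suc i) (suc j) ≈ M i j * T i j * Bw
        term i j i≤a j≤b = begin
          M i j * f (suc i) (suc j)    ≈⟨ *-congˡ (M i j) (f≈J (suc i) (suc j)) ⟩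
          M i j * J w (suc i) (suc j) 0 ≈⟨ *-congˡ (M i j) (J-boundary (suc i) (suc j) (s≤s z≤n) (s≤s z≤n)
            (ℕₚ.≤-<-trans (ℕₚ.+-mono-≤ i≤a j≤b) lt)) ⟩
          M i j * (T i j * Bw)         ≡⟨ ℤₚ.*-assoc (M i j) (T i j) Bw ⟨
          M i j * T i j * Bw           ∎

      J-value : ∀ a b c → suc a ℕ.+ suc b ℕ.+ suc c < w →
        J w (suc a) (suc b) (suc c) ≈ (GZ a b c + GZ a c b + GZ b c a) * Bw
      J-value a b c lt = begin
        J w (suc a) (suc b) (suc c)
          ≈⟨ pathSum₂-unique w (J w) (J-rec w) (suc a) (suc b) (suc c) none (ℕₚ.<⇒≤ lt) ⟩
        pathSum₂ (λ x y → J w x y 0) (suc a) (suc b) (suc c) + pathSum₂ (λ x y → J w x 0 y) (suc a) (suc c) (suc b)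
          + pathSum₂ (J w 0) (suc b) (suc c) (suc a)
          ≈⟨ +-cong (+-cong (pathSum₂≈GZ a b c (ℕₚ.≤-<-trans (ℕₚ.m≤m+n (suc a ℕ.+ suc b) (suc c)) lt)
                               (λ x y → J w x y 0) (λ _ _ → refl))
                            (pathSum₂≈GZ a c b (ℕₚ.≤-<-trans (ℕₚ.+-monoˡ-≤ (suc c) (ℕₚ.m≤m+n (suc a) (suc b))) lt)
                               (λ x y → J w x 0 y) (J-middle w)))
                    (pathSum₂≈GZ b c a (ℕₚ.≤-<-trans (ℕₚ.+-monoˡ-≤ (suc c) (ℕₚ.m≤n+m (suc b) (suc a))) lt)
                       (J w 0) (J-first w)) ⟩
        GZ a b c * Bw + GZ a c b * Bw + GZ b c a * Bw
          ≡⟨ lem (GZ a b c) (GZ a c b) (GZ b c a) Bw ⟩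
        (GZ a b c + GZ a c b + GZ b c a) * Bw ∎
        where
        lem : ∀ a b c d → a * d + b * d + c * d ≡ (a + b + c) * d
        lem = solve-∀

  -- Reduction of rationals modulo p

  open import Defs hiding (_≡_[mod_])
  import Defs

  -- x ↦ a : the rational x is p-integral and its residue modulo p is a.
  infix 4 _↦_
  record _↦_ (x : ℚ) (a : ℤ) : Set where
    constructor reduces
    field
      fraction : ℚᵘ
      equal    : toℚᵘ x ℚᵘ.≃ fraction
      integral : ¬ p ℕD.∣ ↧ₙ fraction
      residue  : ℚᵘ.↥ fraction ≈ a * ℚᵘ.↧ fraction

  ↦-≈ : ∀ {x a b} → x ↦ a → a ≈ b → x ↦ b
  ↦-≈ (reduces u e i r) a≈b = reduces u e i (trans r (*-congʳ (ℚᵘ.↧ u) a≈b))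

  -- Since the witness may be any representing fraction, denominators are simply multiplied, and the
  -- product is prime to p by Euclid's lemma.
  ↦-+ : ∀ {x y a b} → x ↦ a → y ↦ b → x ℚ.+ y ↦ a + b
  ↦-+ {x} {y} {a} {b} (reduces u@(mkℚᵘ m d) e i r) (reduces v@(mkℚᵘ n f) e′ i′ r′) = reduces (u ℚᵘ.+ v)
    (ℚᵘₚ.≃-trans (ℚₚ.toℚᵘ-homo-+ x y) (ℚᵘₚ.+-cong e e′))
    (λ z → *-≉0 (ι≉0 i) (ι≉0 i′) (trans (≡⇒≈ (≡.sym (ℤₚ.pos-* (suc d) (suc f)))) (∣⇒≈0 z)))
    (begin
      m * F + n * D               ≈⟨ +-cong (*-congʳ F r) (*-congʳ D r′) ⟩
      a * D * F + b * F * D       ≡⟨ lem a b D F ⟩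
      (a + b) * (D * F)           ≡⟨ ≡.cong ((a + b) *_) (ℤₚ.pos-* (suc d) (suc f)) ⟨
      (a + b) * ι (suc d ℕ.* suc f) ∎)
    where
    D = ι (suc d)
    F = ι (suc f)
    lem : ∀ a b d f → a * d * f + b * f * d ≡ (a + b) * (d * f)
    lem = solve-∀

  ↦-* : ∀ {x y a b} → x ↦ a → y ↦ b → x ℚ.* y ↦ a * b
  ↦-* {x} {y} {a} {b} (reduces u@(mkℚᵘ m d) e i r) (reduces v@(mkℚᵘ n f) e′ i′ r′) = reduces (u ℚᵘ.* v)
    (ℚᵘₚ.≃-trans (ℚₚ.toℚᵘ-homo-* x y) (ℚᵘₚ.*-cong e e′))
    (λ z → *-≉0 (ι≉0 i) (ι≉0 i′) (trans (≡⇒≈ (≡.sym (ℤₚ.pos-* (suc d) (suc f)))) (∣⇒≈0 z)))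
    (begin
      m * n                       ≈⟨ *-cong r r′ ⟩
      a * D * (b * F)             ≡⟨ lem a b D F ⟩
      a * b * (D * F)             ≡⟨ ≡.cong (a * b *_) (ℤₚ.pos-* (suc d) (suc f)) ⟨
      a * b * ι (suc d ℕ.* suc f) ∎)
    where
    D = ι (suc d)
    F = ι (suc f)
    lem : ∀ a b d f → a * d * (b * f) ≡ a * b * (d * f)
    lem = solve-∀

  ↦-neg : ∀ {x a} → x ↦ a → ℚ.- x ↦ - a
  ↦-neg {x} {a} (reduces u@(mkℚᵘ m d) e i r) = reduces (ℚᵘ.- u)
    (ℚᵘₚ.≃-trans (ℚₚ.toℚᵘ-homo‿- x) (ℚᵘₚ.-‿cong e)) i
    (trans (-‿cong r) (≡⇒≈ (ℤₚ.neg-distribˡ-* a (ι (suc d)))))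

  ↦-ℕ : ∀ n → ℕtoℚ n ↦ ι n
  ↦-ℕ n = reduces (mkℚᵘ (ι n) 0) (ℚₚ.toℚᵘ-fromℚᵘ (mkℚᵘ (ι n) 0)) (∤-< (s≤s z≤n) 1<p) (≡⇒≈ (≡.sym (ℤₚ.*-identityʳ (ι n))))

  1≉0 : ¬ 1ℤ ≈ 0ℤ
  1≉0 = ι≉0 (∤-< (s≤s z≤n) 1<p)

  -- No a satisfies a · 0 ≡ 1, so the dummy value `inv 0` is excluded by the hypothesis.
  ↦-inv : ∀ {a} m → a * ι m ≈ 1ℤ → inv m ↦ a
  ↦-inv {a} zero    e = ⊥-elim (1≉0 (trans (sym e) (≡⇒≈ (ℤₚ.*-zeroʳ a))))
  ↦-inv {a} (suc m) e = reduces (mkℚᵘ 1ℤ m) (ℚₚ.toℚᵘ-fromℚᵘ (mkℚᵘ 1ℤ m))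
    (λ d → 1≉0 (trans (sym e) (trans (*-congˡ a (∣⇒≈0 d)) (≡⇒≈ (ℤₚ.*-zeroʳ a))))) (sym e)

  ↦-iv : ∀ {m} → ¬ p ℕD.∣ m → inv m ↦ iv m
  ↦-iv {m} p∤m = ↦-inv m (trans (≡⇒≈ (ℤₚ.*-comm (iv m) (ι m))) (iv-inverse p∤m))

  ↦-sgn : ∀ n → sgn n ↦ sg n
  ↦-sgn zero    = ↦-ℕ 1
  ↦-sgn (suc n) = ↦-neg (↦-sgn n)

  ↦-sumℚ : ∀ n {f g} → (∀ i → i < n → f i ↦ g i) → sumℚ (applyUpTo f n) ↦ sum g n
  ↦-sumℚ zero    _         = ↦-ℕ 0
  ↦-sumℚ (suc n) {f} {g} r = ↦-≈ (↦-+ (r 0 (s≤s z≤n)) (↦-sumℚ n (λ i i<n → r (suc i) (s≤s i<n)))) (sym (≡⇒≈ (sum-head g n)))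

  ↦-Σ₁ : ∀ n f g → (∀ i → i < n → f (suc i) ↦ g i) → Σ[ 1 to n ] f ↦ sum g n
  ↦-Σ₁ n f g r = ≡.subst (λ l → sumℚ l ↦ sum g n) (≡.sym (map-upTo (λ i → f (1 ℕ.+ i)) n)) (↦-sumℚ n r)

  ↦-Σ₀ : ∀ n f g → (∀ i → i < suc n → f i ↦ g i) → Σ[ 0 to n ] f ↦ sum g (suc n)
  ↦-Σ₀ n f g r = ≡.subst (λ l → sumℚ l ↦ sum g (suc n)) (≡.sym (map-upTo f (suc n))) (↦-sumℚ (suc n) r)

  -- Cross-multiplying the reduced difference with its witness fraction shows that p divides the
  -- reduced numerator times the witness denominator, and the latter is prime to p.
  ↦-sound : ∀ {x y a b} → x ↦ a → y ↦ b → a ≈ b → x Defs.≡ y [mod p ]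
  ↦-sound {x} {y} {a} {b} r s a≈b = go (x ℚ.- y) (↦-≈ (↦-+ r (↦-neg s)) (trans (+-congʳ (- b) a≈b) (≡⇒≈ (ℤₚ.+-inverseʳ b))))
    where
    go : ∀ z → z ↦ 0ℤ → p ℕD.∣ ℤ.∣ ℚ.↥ z ∣
    go z@(mkℚ _ _ _) (reduces u (*≡* e) i r) with *-≈0 (ℚ.↥ z) (ℚᵘ.↧ u) (begin
        ℚ.↥ z * ℚᵘ.↧ u        ≡⟨ e ⟩
        ℚᵘ.↥ u * ℚ.↧ z        ≈⟨ *-congʳ (ℚ.↧ z) r ⟩
        0ℤ * ℚᵘ.↧ u * ℚ.↧ z   ≡⟨⟩
        0ℤ                    ∎)
    ... | inj₁ n≈0 = ≈0⇒∣ n≈0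
    ... | inj₂ d≈0 = ⊥-elim (i (≈0⇒∣ d≈0))

  -- Bernoulli numbers modulo p

  lastℚ-∷ʳ : ∀ xs x → lastℚ (xs ∷ʳ x) ≡ x
  lastℚ-∷ʳ []           x = ≡.refl
  lastℚ-∷ʳ (_ ∷ [])     x = ≡.refl
  lastℚ-∷ʳ (_ ∷ y ∷ xs) x = lastℚ-∷ʳ (y ∷ xs) x

  bernList≡ : ∀ n → bernList n ≡ applyUpTo B (suc n)
  bernList≡ zero    = ≡.refl
  bernList≡ (suc n) =
    ≡.trans (≡.cong₂ _∷ʳ_ (bernList≡ n) (≡.sym (lastℚ-∷ʳ (bernList n) _))) (applyUpTo-∷ʳ B (suc n))

  map-indexed : ∀ (F : ℕ × ℚ → ℚ) f i n → map F (indexed i (applyUpTo f n)) ≡ applyUpTo (λ k → F (i ℕ.+ k , f k)) n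
  map-indexed F f i zero    = ≡.refl
  map-indexed F f i (suc n) = ≡.cong₂ _∷_ (≡.cong (λ k → F (k , f 0)) (≡.sym (ℕₚ.+-identityʳ i)))
    (≡.trans (map-indexed F (f ∘ suc) (suc i) n)
      (applyUpTo-cong n (λ k → ≡.cong (λ m → F (m , f (suc k))) (≡.sym (ℕₚ.+-suc i k)))))
    where
    applyUpTo-cong : ∀ n {f g : ℕ → ℚ} → (∀ k → f k ≡ g k) → applyUpTo f n ≡ applyUpTo g n
    applyUpTo-cong zero    e = ≡.refl
    applyUpTo-cong (suc n) e = ≡.cong₂ _∷_ (e 0) (applyUpTo-cong n (e ∘ suc))

  B-suc : ∀ n → B (suc n) ≡ ℚ.- (inv (2 ℕ.+ n) ℚ.* sumℚ (applyUpTo (λ k → ℕtoℚ ((2 ℕ.+ n) C k) ℚ.* B k) (suc n)))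
  B-suc n = ≡.trans (lastℚ-∷ʳ (bernList n) _)
    (≡.cong (λ l → ℚ.- (inv (2 ℕ.+ n) ℚ.* sumℚ l))
      (≡.trans (≡.cong (λ l → map F (indexed 0 l)) (bernList≡ n)) (map-indexed F B 0 (suc n))))
    where
    F : ℕ × ℚ → ℚ
    F (k , x) = ℕtoℚ ((2 ℕ.+ n) C k) ℚ.* x

  -- Row n holds the residues of B₀, …, Bₙ in its first n+1 entries.
  bernoulliTable : ℕ → Seq

  -- The recursion of `B` with 1/(n + 2) replaced by its integer representative.
  nextBernoulli : ℕ → ℤ
  nextBernoulli n = - (iv (2 ℕ.+ n) * sum (λ i → ι ((2 ℕ.+ n) C i) * bernoulliTable n i) (suc n))

  bernoulliTable zero    k = 1ℤ
  bernoulliTable (suc n) k = if does (k ℕ.≤? n) then bernoulliTable n k else nextBernoulli n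

  b : Seq
  b n = bernoulliTable n n

  bernoulliTable-stable : ∀ n k → k ≤ n → bernoulliTable n k ≡ b k
  bernoulliTable-stable zero    zero _ = ≡.refl
  bernoulliTable-stable (suc n) k    k≤1+n with ℕₚ.m≤n⇒m<n∨m≡n k≤1+n
  ... | inj₂ ≡.refl    = ≡.refl
  ... | inj₁ (s≤s k≤n) = ≡.trans (≡.cong (λ t → if t then bernoulliTable n k else nextBernoulli n) (dec-true (k ℕ.≤? n) k≤n))
                                 (bernoulliTable-stable n k k≤n)

  b-suc : ∀ n → b (suc n) ≡ - (iv (2 ℕ.+ n) * sum (λ i → ι ((2 ℕ.+ n) C i) * b i) (suc n))
  b-suc n = ≡.trans
    (≡.cong (λ t → if t then bernoulliTable n (suc n) else nextBernoulli n) (dec-false (suc n ℕ.≤? n) (ℕₚ.<-irrefl ≡.refl)))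
    (≡.cong (λ s → - (iv (2 ℕ.+ n) * s)) (sum-ext (suc n) (λ i i≤n →
      ≡.cong (ι ((2 ℕ.+ n) C i) *_) (bernoulliTable-stable n i (ℕₚ.≤-pred i≤n)))))

  -- The term k = n + 1 is (n + 2) · b (n + 1), which `b-suc` makes cancel the others once n + 2 is
  -- invertible.
  b-rec : ∀ n → 2 ℕ.+ n < p → sum (λ k → ι ((2 ℕ.+ n) C k) * b k) (2 ℕ.+ n) ≈ 0ℤ
  b-rec n 2+n<p = begin
    S + ι (m C suc n) * b (suc n)    ≡⟨ ≡.cong₂ (λ x y → S + ι x * y) C-last (b-suc n) ⟩
    S + ι m * - (iv m * S)           ≡⟨ lem S (ι m) (iv m) ⟩
    S - ι m * iv m * S               ≈⟨ +-congˡ S (-‿cong (*-congʳ S (iv-inverse (∤-< (s≤s z≤n) 2+n<p)))) ⟩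
    S - 1ℤ * S                       ≡⟨ lem₂ S ⟩
    0ℤ                               ∎
    where
    m = 2 ℕ.+ n
    S = sum (λ k → ι (m C k) * b k) (suc n)
    C-last : m C suc n ≡ m
    C-last = ≡.trans (nCk≡nC[n∸k] (ℕₚ.n≤1+n (suc n))) (≡.trans (≡.cong (m C_) (ℕₚ.m+n∸n≡m 1 (suc n))) (nC1≡n m))
    lem : ∀ s m i → s + m * - (i * s) ≡ s - m * i * s
    lem = solve-∀
    lem₂ : ∀ s → s - 1ℤ * s ≡ 0ℤ
    lem₂ = solve-∀

  open Bernoulli b refl b-rec

  -- Strong induction. The divisors met on the way are at most n + 1 and hence below p; at n = p - 1
  -- the divisor would be p itself.
  ↦-B : ∀ {n} → n < q → B n ↦ b n
  ↦-B {n} n<q = go n n<q n ℕₚ.≤-refl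
    where
    go : ∀ n → n < q → ∀ k → k ≤ n → B k ↦ b k
    go _       _   zero    _         = ↦-ℕ 1
    go (suc n) n<q (suc k) (s≤s k≤n) = ≡.subst₂ _↦_ (≡.sym (B-suc k)) (≡.sym (b-suc k))
      (↦-neg (↦-* (↦-iv (∤-< (s≤s z≤n) (≤q⇒<p (ℕₚ.≤-trans (s≤s (s≤s k≤n)) n<q))))
        (↦-sumℚ (suc k) (λ i i≤k → ↦-* (↦-ℕ ((2 ℕ.+ k) C i)) (go n (ℕₚ.<⇒≤ n<q) i (ℕₚ.≤-trans (ℕₚ.≤-pred i≤k) k≤n))))))

  -- Composition sums and multinomial coefficients

  -- The generating series of the composition sums `Zaux`. Positivity of the parts is automatic: p
  -- divides 0, so each `L s` has constant term 0.
  ζ : List ℕ → Seq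
  ζ []       = δ
  ζ (s ∷ ss) = L s ⊛ ζ ss

  pos-^ : ∀ k s → ι (k ℕ.^ s) ≡ ι k ^ s
  pos-^ k zero    = ≡.refl
  pos-^ k (suc s) = ≡.trans (ℤₚ.pos-* k (k ℕ.^ s)) (≡.cong (ι k *_) (pos-^ k s))

  Zaux-∷ : ∀ N s ss → Zaux p N (s ∷ ss) ≡
    Σ[ 1 to N ] (λ k → if does (p ℕD.∣? k) then 0ℚ else (inv (k ℕ.^ s) ℚ.* Zaux p (N ∸ k) ss))
  Zaux-∷ zero    s ss = ≡.refl
  Zaux-∷ (suc N) s ss = ≡.refl

  ↦-Zaux : ∀ ss N → Zaux p N ss ↦ ζ ss N
  ↦-Zaux []       zero    = ↦-ℕ 1
  ↦-Zaux []       (suc N) = ↦-ℕ 0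
  ↦-Zaux (s ∷ ss) N       = ↦-≈
    (≡.subst (_↦ sum residues N) (≡.sym (Zaux-∷ N s ss)) (↦-Σ₁ N summand residues (λ i _ → term (suc i))))
    (sym (begin
      (L s ⊛ ζ ss) N                              ≡⟨ ⊛-sum (L s) (ζ ss) N ⟩
      sum (λ i → L s i * ζ ss (N ∸ i)) (suc N)    ≡⟨ sum-head (λ i → L s i * ζ ss (N ∸ i)) N ⟩
      L s 0 * ζ ss N + sum residues N             ≡⟨ ≡.cong (λ z → z * ζ ss N + sum residues N) (L-0 s) ⟩
      0ℤ + sum residues N                         ≡⟨ ℤₚ.+-identityˡ (sum residues N) ⟩
      sum residues N                              ∎))
    where
    residues : Seq
    residues i = L s (suc i) * ζ ss (N ∸ suc i)
    summand : ℕ → ℚ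
    summand k = if does (p ℕD.∣? k) then 0ℚ else (inv (k ℕ.^ s) ℚ.* Zaux p (N ∸ k) ss)
    term : ∀ k → summand k ↦ L s k * ζ ss (N ∸ k)
    term k with p ℕD.∣? k
    ... | yes _  = ↦-ℕ 0
    ... | no p∤k = ↦-* (↦-inv {iv k ^ s} (k ℕ.^ s) (begin
      iv k ^ s * ι (k ℕ.^ s)   ≡⟨ ≡.cong (iv k ^ s *_) (pos-^ k s) ⟩
      iv k ^ s * ι k ^ s       ≡⟨ ℤₚ.*-comm (iv k ^ s) (ι k ^ s) ⟩
      ι k ^ s * iv k ^ s       ≈⟨ iv^-inverse s p∤k ⟩
      1ℤ                       ∎)) (↦-Zaux ss (N ∸ k))

  -- The two binomial coefficients of `paths₂` share the factor (j + k)!, once above and once below.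
  paths₂-factorial : ∀ i j k → paths₂ i j (suc k) ℕ.* (i ! ℕ.* j ! ℕ.* k !) ≡ (i ℕ.+ j ℕ.+ k) !
  paths₂-factorial i j k = R.begin
    paths j (suc k) ℕ.* paths i (j ℕ.+ suc k) ℕ.* (i ! ℕ.* j ! ℕ.* k !)
      R.≡⟨ ≡.cong (λ n → paths j (suc k) ℕ.* paths i n ℕ.* (i ! ℕ.* j ! ℕ.* k !)) (ℕₚ.+-suc j k) ⟩
    paths j (suc k) ℕ.* paths i (suc (j ℕ.+ k)) ℕ.* (i ! ℕ.* j ! ℕ.* k !)
      R.≡⟨ ≡.cong₂ (λ x y → x ℕ.* y ℕ.* (i ! ℕ.* j ! ℕ.* k !)) (paths≡C j k) (paths≡C i (j ℕ.+ k)) ⟩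
    ((j ℕ.+ k) C j) ℕ.* ((i ℕ.+ (j ℕ.+ k)) C i) ℕ.* (i ! ℕ.* j ! ℕ.* k !)
      R.≡⟨ lem ((j ℕ.+ k) C j) ((i ℕ.+ (j ℕ.+ k)) C i) (i !) (j !) (k !) ⟩
    ((i ℕ.+ (j ℕ.+ k)) C i) ℕ.* (i ! ℕ.* (((j ℕ.+ k) C j) ℕ.* (j ! ℕ.* k !)))
      R.≡⟨ ≡.cong (λ x → ((i ℕ.+ (j ℕ.+ k)) C i) ℕ.* (i ! ℕ.* x)) (C-factorial′ j k) ⟩
    ((i ℕ.+ (j ℕ.+ k)) C i) ℕ.* (i ! ℕ.* (j ℕ.+ k) !)
      R.≡⟨ C-factorial′ i (j ℕ.+ k) ⟩
    (i ℕ.+ (j ℕ.+ k)) !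
      R.≡⟨ ≡.cong _! (ℕₚ.+-assoc i j k) ⟨
    (i ℕ.+ j ℕ.+ k) ! R.∎
    where
    module R = ≡.≡-Reasoning
    C-factorial′ : ∀ m n → ((m ℕ.+ n) C m) ℕ.* (m ! ℕ.* n !) ≡ (m ℕ.+ n) !
    C-factorial′ m n = ≡.trans (≡.cong (λ k → ((m ℕ.+ n) C m) ℕ.* (m ! ℕ.* k !)) (≡.sym (ℕₚ.m+n∸m≡n m n))) (C-factorial (ℕₚ.m≤m+n m n))
    lem : ∀ a b c d e → a ℕ.* b ℕ.* (c ℕ.* d ℕ.* e) ≡ b ℕ.* (c ℕ.* (a ℕ.* (d ℕ.* e)))
    lem = solveℕ-∀

  ↦-multinom : ∀ i j k → i < p → j < p → k < p → multinom i j k ↦ ι (paths₂ i j (suc k))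
  ↦-multinom i j k i<p j<p k<p = ↦-≈ (↦-* (↦-ℕ ((i ℕ.+ j ℕ.+ k) !)) (↦-iv p∤d)) (begin
    ι ((i ℕ.+ j ℕ.+ k) !) * iv d              ≡⟨ ≡.cong (λ n → ι n * iv d) (paths₂-factorial i j k) ⟨
    ι (paths₂ i j (suc k) ℕ.* d) * iv d       ≡⟨ ≡.cong (_* iv d) (ℤₚ.pos-* (paths₂ i j (suc k)) d) ⟩
    ι (paths₂ i j (suc k)) * ι d * iv d       ≡⟨ ℤₚ.*-assoc (ι (paths₂ i j (suc k))) (ι d) (iv d) ⟩
    ι (paths₂ i j (suc k)) * (ι d * iv d)     ≈⟨ *-congˡ (ι (paths₂ i j (suc k))) (iv-inverse p∤d) ⟩
    ι (paths₂ i j (suc k)) * 1ℤ               ≡⟨ ℤₚ.*-identityʳ (ι (paths₂ i j (suc k))) ⟩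
    ι (paths₂ i j (suc k))                    ∎)
    where
    d = i ! ℕ.* j ! ℕ.* k !
    p∤d : ¬ p ℕD.∣ d
    p∤d z = *-≉0 (*-≉0 (!≉0 i<p) (!≉0 j<p)) (!≉0 k<p)
      (trans (≡⇒≈ (≡.trans (≡.cong (_* ι (k !)) (≡.sym (ℤₚ.pos-* (i !) (j !)))) (≡.sym (ℤₚ.pos-* (i ! ℕ.* j !) (k !))))) (∣⇒≈0 z))

  odd⇒sg : ∀ n → ¬ 2 ℕD.∣ n → sg n ≡ - 1ℤ
  odd⇒sg zero          ¬2∣n = ⊥-elim (¬2∣n (2 ℕD.∣0))
  odd⇒sg (suc zero)    ¬2∣n = ≡.refl
  odd⇒sg (suc (suc n)) ¬2∣n = ≡.trans (ℤₚ.neg-involutive (sg n)) (odd⇒sg n (¬2∣n ∘ ℕD.∣m∣n⇒∣m+n ℕD.∣-refl))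

  -- Residues of the right-hand side and the final congruence

  module Transfer (w : ℕ) (2+w<p : w ℕ.+ 2 < p) (odd : sg w ≡ - 1ℤ) where
    open Weight w 2+w<p odd

    ↦-h : ∀ x y z → 0 < x → x ℕ.+ y ℕ.+ z ≡ w → h x y z ↦ hZ x y z
    ↦-h x y z 0<x ≡.refl = ↦-* (↦-iv (p∤2w (ℕₚ.<-≤-trans 0<x (ℕₚ.≤-trans (ℕₚ.m≤m+n x y) (ℕₚ.m≤m+n (x ℕ.+ y) z)))))
      (↦-+ (↦-* (↦-sgn x) (↦-ℕ (w C x))) (↦-neg (↦-* (↦-sgn z) (↦-ℕ (w C z)))))

    ↦-t : ∀ x y z → 0 < x → 0 < y → x ℕ.+ y ℕ.+ z ≡ w → t x y z ↦ tZ x y z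
    ↦-t x@(suc x′) y@(suc y′) z _ _ e = ↦-+ (↦-half x′ y e) (↦-half y′ x (≡.trans (≡.cong (ℕ._+ z) (ℕₚ.+-comm y x)) e))
      where
      lem : ∀ a b c → a ℕ.+ (b ℕ.+ c) ≡ a ℕ.+ c ℕ.+ b
      lem = solveℕ-∀
      total : ∀ x y s → s < x → x ℕ.+ y ℕ.+ z ≡ w → x ∸ s ℕ.+ (y ℕ.+ s) ℕ.+ z ≡ w
      total x y s s<x e = ≡.trans (≡.cong (ℕ._+ z) (≡.trans (lem (x ∸ s) y s) (≡.cong (ℕ._+ y) (ℕₚ.m∸n+n≡m (ℕₚ.<⇒≤ s<x))))) e
      ↦-half : ∀ x′ y → suc x′ ℕ.+ y ℕ.+ z ≡ w →
        Σ[ 0 to x′ ] (λ s → ℕtoℚ ((s ℕ.+ y ∸ 1) C s) ℚ.* h (suc x′ ∸ s) (y ℕ.+ s) z) ↦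
        sum (λ s → ι ((s ℕ.+ y ∸ 1) C s) * hZ (suc x′ ∸ s) (y ℕ.+ s) z) (suc x′)
      ↦-half x′ y e = ↦-Σ₀ x′ (λ s → ℕtoℚ ((s ℕ.+ y ∸ 1) C s) ℚ.* h (suc x′ ∸ s) (y ℕ.+ s) z)
        (λ s → ι ((s ℕ.+ y ∸ 1) C s) * hZ (suc x′ ∸ s) (y ℕ.+ s) z)
        (λ s s<x → ↦-* (↦-ℕ ((s ℕ.+ y ∸ 1) C s)) (↦-h (suc x′ ∸ s) (y ℕ.+ s) z (ℕₚ.m<n⇒0<n∸m s<x) (total (suc x′) y s s<x e)))

    ↦-G : ∀ a b c → suc a ℕ.+ suc b ≤ w → c < p →
      Σ[ 1 to suc a ] (λ x → Σ[ 1 to suc b ] (λ y → multinom (suc a ∸ x) (suc b ∸ y) c ℚ.* t x y (w ∸ x ∸ y))) ↦ GZ a b c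
    ↦-G a b c le c<p = ↦-Σ₁ (suc a) (λ x → Σ[ 1 to suc b ] (f x)) (λ i → sum (g i) (suc b))
      (λ i i≤a → ↦-Σ₁ (suc b) (f (suc i)) (g i) (λ j j≤b → ↦-*
        (↦-multinom (a ∸ i) (b ∸ j) c
          (small a i (ℕₚ.≤-trans (ℕₚ.m≤m+n (suc a) (suc b)) le))
          (small b j (ℕₚ.≤-trans (ℕₚ.m≤n+m (suc b) (suc a)) le)) c<p)
        (↦-t (suc i) (suc j) (w ∸ suc i ∸ suc j) (s≤s z≤n) (s≤s z≤n) (total i j (ℕₚ.≤-trans (ℕₚ.+-mono-≤ i≤a j≤b) le)))))
      where
      f : ℕ → ℕ → ℚ
      f x y = multinom (suc a ∸ x) (suc b ∸ y) c ℚ.* t x y (w ∸ x ∸ y)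
      g : ℕ → Seq
      g i j = ι (paths₂ (a ∸ i) (b ∸ j) (suc c)) * tZ (suc i) (suc j) (w ∸ suc i ∸ suc j)
      small : ∀ m i → suc m ≤ w → m ∸ i < p
      small m i m<w = ℕₚ.≤-<-trans (ℕₚ.m∸n≤m m i) (ℕₚ.<-trans m<w (≤q⇒<p (ℕₚ.<⇒≤ w<q)))
      total : ∀ i j → suc i ℕ.+ suc j ≤ w → suc i ℕ.+ suc j ℕ.+ (w ∸ suc i ∸ suc j) ≡ w
      total i j le = ≡.trans (≡.cong (suc i ℕ.+ suc j ℕ.+_) (ℕₚ.∸-+-assoc w (suc i) (suc j))) (ℕₚ.m+[n∸m]≡n le)

  Z-value : ∀ α β γ l → 0 < α → 0 < β → 0 < γ → 0 < l → let w = α ℕ.+ β ℕ.+ γ ℕ.+ l in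
    ¬ 2 ℕD.∣ w → w ℕ.+ 2 < p →
    Z p (α ∷ β ∷ γ ∷ l ∷ []) Defs.≡ sgn l ℚ.*
      ((Σ[ 1 to α ] (λ a → Σ[ 1 to β ] (λ b → multinom (α ∸ a) (β ∸ b) (γ ∸ 1) ℚ.* t a b (w ∸ a ∸ b)))
        ℚ.+ Σ[ 1 to α ] (λ a → Σ[ 1 to γ ] (λ c → multinom (α ∸ a) (γ ∸ c) (β ∸ 1) ℚ.* t a c (w ∸ a ∸ c)))
        ℚ.+ Σ[ 1 to β ] (λ b → Σ[ 1 to γ ] (λ c → multinom (β ∸ b) (γ ∸ c) (α ∸ 1) ℚ.* t b c (w ∸ b ∸ c))))
      ℚ.* B (p ∸ w)) [mod p ]
  Z-value α@(suc a) β@(suc b′) γ@(suc c) l@(suc _) _ _ _ 0<l ¬2∣w w+2<p = ↦-sound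
    (↦-Zaux (α ∷ β ∷ γ ∷ l ∷ []) p)
    (↦-* (↦-sgn l) (↦-*
      (↦-+ (↦-+ (↦-G a b′ c α+β≤w (smaller γ≤w)) (↦-G a c b′ α+γ≤w (smaller β≤w))) (↦-G b′ c a β+γ≤w (smaller α≤w)))
      -- The index p - w lies below p - 1 because w is at least α + β, hence at least 2.
      (↦-B (ℕₚ.∸-monoʳ-<
        (ℕₚ.≤-trans (ℕₚ.+-mono-≤ {1} {α} {1} {β} (s≤s z≤n) (s≤s z≤n)) α+β≤w) (ℕₚ.<⇒≤ w<p)))))
    (trans (L⊛⁴-value α β γ l) (*-congˡ (sg l) (J-value a b′ c (ℕₚ.m<m+n (α ℕ.+ β ℕ.+ γ) 0<l))))
    where
    w = α ℕ.+ β ℕ.+ γ ℕ.+ l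
    open Transfer w w+2<p (odd⇒sg w ¬2∣w)
    open Weight w w+2<p (odd⇒sg w ¬2∣w)
    w<p : w < p
    w<p = ≤q⇒<p (ℕₚ.<⇒≤ w<q)
    n≤w : α ℕ.+ β ℕ.+ γ ≤ w
    n≤w = ℕₚ.m≤m+n (α ℕ.+ β ℕ.+ γ) l
    α+β≤w : α ℕ.+ β ≤ w
    α+β≤w = ℕₚ.≤-trans (ℕₚ.m≤m+n (α ℕ.+ β) γ) n≤w
    α+γ≤w : α ℕ.+ γ ≤ w
    α+γ≤w = ℕₚ.≤-trans (ℕₚ.+-monoˡ-≤ γ (ℕₚ.m≤m+n α β)) n≤w
    β+γ≤w : β ℕ.+ γ ≤ w
    β+γ≤w = ℕₚ.≤-trans (ℕₚ.+-monoˡ-≤ γ (ℕₚ.m≤n+m β α)) n≤w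
    α≤w = ℕₚ.≤-trans (ℕₚ.m≤m+n α β) α+β≤w
    β≤w = ℕₚ.≤-trans (ℕₚ.m≤n+m β α) α+β≤w
    γ≤w = ℕₚ.≤-trans (ℕₚ.m≤n+m γ α) α+γ≤w
    smaller : ∀ {m} → suc m ≤ w → m < p
    smaller m<w = ℕₚ.<-trans m<w w<p

open import Defs
open import Data.Nat using (_+_; _∸_; _>_; NonZero; >-nonZero⁻¹)
open import Data.List using (_∷_; [])
open import Data.Rational using () renaming (_+_ to _+ℚ_; _*_ to _*ℚ_)
open import Relation.Nullary using (¬_)
open import Data.Nat.Divisibility using (_∣_)

theorem3p3 : (p α β γ λ' : ℕ) → Prime p → .{{_ : NonZero α}} → .{{_ : NonZero β}} → .{{_ : NonZero γ}} → .{{_ : NonZero λ'}} →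
    ¬ (2 ∣ (α + β + γ + λ')) → p > α + β + γ + λ' + 2 →
    Z p (α ∷ β ∷ γ ∷ λ' ∷ []) ≡
      sgn λ' *ℚ
        ((Σ[ 1 to α ] (λ a → Σ[ 1 to β ] (λ b →
             multinom (α ∸ a) (β ∸ b) (γ ∸ 1) *ℚ t a b (α + β + γ + λ' ∸ a ∸ b)))
          +ℚ Σ[ 1 to α ] (λ a → Σ[ 1 to γ ] (λ c →
             multinom (α ∸ a) (γ ∸ c) (β ∸ 1) *ℚ t a c (α + β + γ + λ' ∸ a ∸ c)))
          +ℚ Σ[ 1 to β ] (λ b → Σ[ 1 to γ ] (λ c →
             multinom (β ∸ b) (γ ∸ c) (α ∸ 1) *ℚ t b c (α + β + γ + λ' ∸ b ∸ c))))
        *ℚ B (p ∸ (α + β + γ + λ')))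
      [mod p ]
theorem3p3 p α β γ λ' pr odd p>w+2 = Residues.Z-value p pr α β γ λ'
  (>-nonZero⁻¹ α) (>-nonZero⁻¹ β) (>-nonZero⁻¹ γ) (>-nonZero⁻¹ λ') odd p>w+2
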